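{- Let $M=(E,G)$ be a claw-free matroid and let $H$ be a hyperplane of $G$ such that $M|H$ has a decomposer. Then at least one of the following holds: $M$ is even-plane; $M$ is a PG-sum; $M^c$ is triangle-free; or $M$ has a decomposer.
   Context: A matroid is a pair $M=(E,G)$ where $G$ is the set of nonzero vectors of a finite-dimensional $\mathbb F_2$-vector space $V(G)=G\cup\{0\}$ and $E\subseteq G$. A flat of $G$ is a set $F\subseteq G$ with $F\cup\{0\}$ a subspace; triangles, planes and hyperplanes are flats of dimension $2$, $3$ and $\dim(G)-1$. $M|F=(E\cap F,F)$. A claw is $(B,G)$ with $\dim G=3$, $B$ a basis; $M$ is claw-free if no $M|F$ is isomorphic (via a linear isomorphism) to a claw. $M$ is even-plane if $|E\cap P|$ is even for every plane $P$. $M$ is a PG-sum if $E$ is the disjoint union of two (possibly empty) flats. $M^c=(G\setminus E,G)$; triangle-free means the ground set contains no triangle. For a flat $F$ of an ambient geometry $G'$ of a matroid $(E',G')$, a coset of $F$ is $x+(F\cup\{0\})$ with $x\in G'\setminus F$; it is mixed if it meets both $E'$ and $G'\setminus E'$; a decomposer of $(E',G')$ is a nonempty flat $F\ne G'$ of $G'$ with no mixed cosets. -}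

module Defs where

open import Data.Bool using (Bool; true; false; _xor_; _∧_; _∨_; not; if_then_else_)
open import Data.Nat using (ℕ; zero; suc; _+_)
open import Data.Vec using (Vec; []; _∷_; zipWith; replicate)
open import Data.Vec.Membership.Propositional using (_∈_)
open import Data.List using (List; map; _++_) renaming ([] to []ˡ; _∷_ to _∷ˡ_)
open import Data.Product using (Σ; ∃; _×_; _,_)
open import Data.Sum using (_⊎_)
open import Relation.Nullary using (¬_)
open import Relation.Binary.PropositionalEquality using (_≡_; _≢_)

-- Ambient space V(G) = F_2^n, vectors are bit vectors.
V : ℕ → Set
V n = Vec Bool n

_⊕_ : ∀ {n} → V n → V n → V n
_⊕_ = zipWith _xor_

0v : ∀ {n} → V n
0v = replicate _ false

-- Subsets of V(G) are Bool-valued predicates (all subsets of a finite set are decidable).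
Sub : ℕ → Set
Sub n = V n → Bool

_∋_ : ∀ {n} → Sub n → V n → Set
S ∋ x = S x ≡ true

isZero : ∀ {n} → V n → Bool
isZero [] = true
isZero (b ∷ v) = not b ∧ isZero v

Gfull : ∀ {n} → Sub n
Gfull x = not (isZero x)

-- A matroid (E, G) with dim G = n: E ⊆ G, i.e. 0 ∉ E.
IsMatroid : ∀ {n} → Sub n → Set
IsMatroid E = E 0v ≡ false

allVecs : (n : ℕ) → List (V n)
allVecs zero = [] ∷ˡ []ˡ
allVecs (suc n) = map (false ∷_) (allVecs n) ++ map (true ∷_) (allVecs n)

countL : ∀ {n} → Sub n → List (V n) → ℕ
countL S []ˡ = 0
countL S (x ∷ˡ xs) = if S x then suc (countL S xs) else countL S xs

card : ∀ {n} → Sub n → ℕ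
card {n} S = countL S (allVecs n)

Even : ℕ → Set
Even k = ∃ λ j → k ≡ j + j

-- Flats: F ⊆ G with F ∪ {0} a subspace (over F_2: closed under addition).
IsFlat : ∀ {n} → Sub n → Set
IsFlat F = (F 0v ≡ false) × (∀ x y → F ∋ x → F ∋ y → x ≢ y → F ∋ (x ⊕ y))

lincomb : ∀ {n k} → Vec Bool k → Vec (V n) k → V n
lincomb [] [] = 0v
lincomb (c ∷ cs) (b ∷ bs) = if c then b ⊕ lincomb cs bs else lincomb cs bs

LinIndep : ∀ {n k} → Vec (V n) k → Set
LinIndep {k = k} bs = ∀ (c : Vec Bool k) → lincomb c bs ≡ 0v → c ≡ replicate k false

InSpan : ∀ {n k} → Vec (V n) k → V n → Set
InSpan {k = k} bs x = ∃ λ (c : Vec Bool k) → lincomb c bs ≡ x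

-- bs is a basis of (the subspace F ∪ {0} of) the flat F
IsBasisOf : ∀ {n k} → Vec (V n) k → Sub n → Set
IsBasisOf bs F = LinIndep bs × (∀ x → x ≢ 0v → ((F ∋ x → InSpan bs x) × (InSpan bs x → F ∋ x)))

IsFlatOfDim : ∀ {n} → Sub n → ℕ → Set
IsFlatOfDim {n} F k = IsFlat F × Σ (Vec (V n) k) (λ bs → IsBasisOf bs F)

IsTriangle IsPlane : ∀ {n} → Sub n → Set
IsTriangle F = IsFlatOfDim F 2
IsPlane F = IsFlatOfDim F 3

-- M | P is isomorphic (via a linear isomorphism) to a claw, P a plane:
-- E ∩ P is a basis of P.
ClawAt : ∀ {n} → Sub n → Sub n → Set
ClawAt {n} E P = IsPlane P ×
  Σ (Vec (V n) 3) (λ bs → IsBasisOf bs P × (∀ x → ((E ∋ x × P ∋ x) → x ∈ bs) × (x ∈ bs → (E ∋ x × P ∋ x))))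

ClawFree : ∀ {n} → Sub n → Set
ClawFree E = ∀ P → ¬ ClawAt E P

EvenPlane : ∀ {n} → Sub n → Set
EvenPlane E = ∀ P → IsPlane P → Even (card (λ x → E x ∧ P x))

PGSum : ∀ {n} → Sub n → Set
PGSum {n} E = Σ (Sub n) λ F₁ → Σ (Sub n) λ F₂ →
  IsFlat F₁ × IsFlat F₂ × (∀ x → E x ≡ (F₁ x ∨ F₂ x)) × (∀ x → F₁ ∋ x → F₂ x ≡ false)

ComplementTriangleFree : ∀ {n} → Sub n → Set
ComplementTriangleFree E = ∀ T → IsTriangle T → ¬ (∀ x → T ∋ x → (Gfull ∋ x × E x ≡ false))

InCoset : ∀ {n} → Sub n → V n → V n → Set
InCoset F x y = (x ⊕ y ≡ 0v) ⊎ (F ∋ (x ⊕ y))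

-- Decomposer of the matroid (E ∩ G', G'), where G' is a flat of the ambient space:
-- a nonempty flat F ≠ G' of G' with no mixed cosets.
IsDecomposer : ∀ {n} → Sub n → Sub n → Sub n → Set
IsDecomposer {n} E G' F =
  IsFlat F × (∀ x → F ∋ x → G' ∋ x) × (∃ λ x → F ∋ x) × (∃ λ x → G' ∋ x × F x ≡ false) ×
  (∀ x → G' ∋ x → F x ≡ false →
     ¬ (Σ (V n) λ y → Σ (V n) λ z →
          InCoset F x y × InCoset F x z × (E ∋ y × G' ∋ y) × (G' ∋ z × E z ≡ false)))

HasDecomposer : ∀ {n} → Sub n → Sub n → Set
HasDecomposer {n} E G' = Σ (Sub n) (IsDecomposer E G')

-- Write f for the indicator function of E, U = H ∪ {0}, and W = F ∪ {0} for a decomposer F of M|H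
-- of minimal size.  If f is constant on every coset of W off U, then F decomposes M, so let N be
-- the nonempty set of nonconstant cosets off U.  For a in N let K a be the stabiliser in W of f on
-- a + W. Claws through two cosets a + W, b + W and a point u of W tie the invariance under u to f u
-- and to f (a + b), and minimality of F collapses every subspace built from these data: if f takes
-- both values on W ∖ {0}, then f (a + b) = 0 with a, b in N forces F ∩ E to be the disjoint union
-- of K a ∖ {0} and K b ∖ {0}, no third coset is in N, and M is a PG-sum or has a decomposer; if no
-- such pair exists, the differences of N span a subspace L for which ⟨L, a⟩ is a decomposer, unless
-- L = U, and then the complement is triangle-free.  If f is constant on W ∖ {0}, then |W| = 2.
-- When that constant is 1, the same span argument applies to a larger generating set.  When it is
-- 0, the second differences of f off U agree with those of f on U in every direction where f
-- vanishes; so either these directions span U and f is quadratic (M is even-plane), or they span a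
-- proper subspace, which gives a decomposer or a triangle-free complement.
module Submission where

open import Defs
open import Data.Nat using (ℕ; suc)
open import Data.Sum using (_⊎_)

open import Data.Bool using (Bool; true; false; not; _xor_; _∧_; _∨_)
open import Data.Bool.Properties
  using (xor-assoc; xor-comm; xor-identityˡ; xor-identityʳ; xor-same; xor-annihilates-not; ¬-not;
         not-involutive; not-distribˡ-xor; ∧-identityʳ; ∧-zeroʳ)
  renaming (_≟_ to _≟ᵇ_)
open import Data.Bool.Solver using (module xor-∧-Solver)
open import Data.Empty using (⊥; ⊥-elim)
open import Data.Fin using (Fin; zero; suc; combine; remQuot)
open import Data.Fin.Properties using (combine-injective; combine-remQuot; pigeonhole; <⇒≢)
open import Data.List using (List; map; _++_; cartesianProductWith) renaming ([] to []ˡ; _∷_ to _∷ˡ_)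
open import Data.List.Membership.Propositional using (lose) renaming (_∈_ to _∈ˡ_)
open import Data.List.Membership.Propositional.Properties
  using (∈-map⁺; ∈-++⁺ˡ; ∈-++⁺ʳ; ∈-cartesianProductWith⁺)
open import Data.List.Relation.Unary.Any using (here; there; any?; satisfied)
open import Data.Nat using (zero; _^_; _≤_; _<_; z≤n; s≤s)
open import Data.Nat.Properties using (≤-trans; ≤-refl; m≤n⇒m≤1+n; n<1+n; ^-monoʳ-<; +-suc)
open import Data.Product using (Σ; ∃; _×_; _,_; proj₁; proj₂)
open import Data.Sum using (inj₁; inj₂)
open import Data.Vec using (Vec; []; _∷_; lookup; tail)
open import Data.Vec.Membership.Propositional using (_∈_)
open import Data.Vec.Properties
  using (zipWith-assoc; zipWith-comm; zipWith-identityˡ; zipWith-identityʳ; ≡-dec; ∷-injective)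
open import Data.Vec.Relation.Unary.Any using () renaming (here to hereᵛ; there to thereᵛ)
open import Function using (_∘_; case_of_)
import Relation.Binary.Reflection as Reflection
open import Relation.Binary.PropositionalEquality
  using (_≡_; _≢_; refl; sym; trans; cong; cong₂; subst; setoid; module ≡-Reasoning)
open import Relation.Nullary using (¬_; Dec; yes; no)
open import Relation.Nullary.Decidable
  using (decidable-stable; isYes; map′; _×-dec_; _⊎-dec_; _→-dec_; ¬?)

-- Vectors over 𝔽₂

-- The hinge is `constant-value`: a constant coset off `U` has the value `f (a ⊕ b)` for every `a`
-- in `N`. Reading one constant coset from two members `a`, `a′` of `N` shows that `f` on `U` does
-- not notice the difference `a ⊕ a′`, which is why differences of `N` generate the candidate
-- decomposers. Membership in stabilisers and spans of such predicates is not decided, so the core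
-- refutes the failure of all four outcomes, and many facts appear under a double negation. Only the
-- subspaces that become flats of the matroid are turned into Boolean functions.

⊕-assoc : ∀ {n} (x y z : V n) → (x ⊕ y) ⊕ z ≡ x ⊕ (y ⊕ z)
⊕-assoc = zipWith-assoc xor-assoc

⊕-comm : ∀ {n} (x y : V n) → x ⊕ y ≡ y ⊕ x
⊕-comm = zipWith-comm xor-comm

⊕-identityˡ : ∀ {n} (x : V n) → 0v ⊕ x ≡ x
⊕-identityˡ = zipWith-identityˡ xor-identityˡ

⊕-identityʳ : ∀ {n} (x : V n) → x ⊕ 0v ≡ x
⊕-identityʳ = zipWith-identityʳ xor-identityʳ

⊕-self : ∀ {n} (x : V n) → x ⊕ x ≡ 0v
⊕-self [] = refl
⊕-self (b ∷ x) = cong₂ _∷_ (xor-same b) (⊕-self x)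

interchange : ∀ {n} (a b c d : V n) → (a ⊕ b) ⊕ (c ⊕ d) ≡ (a ⊕ c) ⊕ (b ⊕ d)
interchange a b c d = begin
  (a ⊕ b) ⊕ (c ⊕ d) ≡⟨ ⊕-assoc a b (c ⊕ d) ⟩
  a ⊕ (b ⊕ (c ⊕ d)) ≡⟨ cong (a ⊕_) (⊕-assoc b c d) ⟨
  a ⊕ ((b ⊕ c) ⊕ d) ≡⟨ cong (λ t → a ⊕ (t ⊕ d)) (⊕-comm b c) ⟩
  a ⊕ ((c ⊕ b) ⊕ d) ≡⟨ cong (a ⊕_) (⊕-assoc c b d) ⟩
  a ⊕ (c ⊕ (b ⊕ d)) ≡⟨ ⊕-assoc a c (b ⊕ d) ⟨
  (a ⊕ c) ⊕ (b ⊕ d) ∎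
  where open ≡-Reasoning

lincomb-⊕ : ∀ {n k} (c d : Vec Bool k) (bs : Vec (V n) k) →
  lincomb (c ⊕ d) bs ≡ lincomb c bs ⊕ lincomb d bs
lincomb-⊕ [] [] [] = sym (⊕-identityˡ 0v)
lincomb-⊕ (false ∷ c) (false ∷ d) (b ∷ bs) = lincomb-⊕ c d bs
lincomb-⊕ (false ∷ c) (true ∷ d) (b ∷ bs) = begin
  b ⊕ lincomb (c ⊕ d) bs ≡⟨ cong (b ⊕_) (lincomb-⊕ c d bs) ⟩
  b ⊕ (lincomb c bs ⊕ lincomb d bs) ≡⟨ ⊕-assoc b _ _ ⟨
  (b ⊕ lincomb c bs) ⊕ lincomb d bs ≡⟨ cong (_⊕ lincomb d bs) (⊕-comm b _) ⟩
  (lincomb c bs ⊕ b) ⊕ lincomb d bs ≡⟨ ⊕-assoc _ b _ ⟩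
  lincomb c bs ⊕ (b ⊕ lincomb d bs) ∎
  where open ≡-Reasoning
lincomb-⊕ (true ∷ c) (false ∷ d) (b ∷ bs) =
  trans (cong (b ⊕_) (lincomb-⊕ c d bs)) (sym (⊕-assoc b _ _))
lincomb-⊕ (true ∷ c) (true ∷ d) (b ∷ bs) = begin
  lincomb (c ⊕ d) bs ≡⟨ lincomb-⊕ c d bs ⟩
  lincomb c bs ⊕ lincomb d bs ≡⟨ ⊕-identityˡ _ ⟨
  0v ⊕ (lincomb c bs ⊕ lincomb d bs) ≡⟨ cong (_⊕ _) (⊕-self b) ⟨
  (b ⊕ b) ⊕ (lincomb c bs ⊕ lincomb d bs) ≡⟨ interchange b b _ _ ⟩
  (b ⊕ lincomb c bs) ⊕ (b ⊕ lincomb d bs) ∎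
  where open ≡-Reasoning

lincomb-0 : ∀ {n k} (bs : Vec (V n) k) → lincomb 0v bs ≡ 0v
lincomb-0 [] = refl
lincomb-0 (b ∷ bs) = lincomb-0 bs

unit : ∀ {k} → Fin k → V k
unit zero = true ∷ 0v
unit (suc i) = false ∷ unit i

lincomb-unit : ∀ {n k} (i : Fin k) (bs : Vec (V n) k) → lincomb (unit i) bs ≡ lookup bs i
lincomb-unit zero (b ∷ bs) = trans (cong (b ⊕_) (lincomb-0 bs)) (⊕-identityʳ b)
lincomb-unit (suc i) (b ∷ bs) = lincomb-unit i bs

-- Two sums of vectors agree as soon as their coefficient vectors do.
infixl 6 _:+_
infix 4 _⊜_

data Expr (k : ℕ) : Set where
  var : Fin k → Expr k
  :0 : Expr k
  _:+_ : Expr k → Expr k → Expr k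

_⊜_ : ∀ {k} → Expr k → Expr k → Expr k × Expr k
_⊜_ = _,_

module _ {n : ℕ} where

  ⟦_⟧ : ∀ {k} → Expr k → Vec (V n) k → V n
  ⟦ var i ⟧ ρ = lookup ρ i
  ⟦ :0 ⟧ ρ = 0v
  ⟦ e :+ e′ ⟧ ρ = ⟦ e ⟧ ρ ⊕ ⟦ e′ ⟧ ρ

  coefficients : ∀ {k} → Expr k → V k
  coefficients (var i) = unit i
  coefficients :0 = 0v
  coefficients (e :+ e′) = coefficients e ⊕ coefficients e′

  ⟦_⇓⟧ : ∀ {k} → Expr k → Vec (V n) k → V n
  ⟦ e ⇓⟧ ρ = lincomb (coefficients e) ρ

  ⇓-correct : ∀ {k} (e : Expr k) ρ → ⟦ e ⇓⟧ ρ ≡ ⟦ e ⟧ ρ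
  ⇓-correct (var i) ρ = lincomb-unit i ρ
  ⇓-correct :0 ρ = lincomb-0 ρ
  ⇓-correct (e :+ e′) ρ =
    trans (lincomb-⊕ (coefficients e) (coefficients e′) ρ) (cong₂ _⊕_ (⇓-correct e ρ) (⇓-correct e′ ρ))

  open Reflection (setoid (V n)) var ⟦_⟧ ⟦_⇓⟧ ⇓-correct public using (solve)

cancelˡ : ∀ {n} (a x : V n) → a ⊕ (a ⊕ x) ≡ x
cancelˡ = solve 2 (λ a x → a :+ (a :+ x) ⊜ x) refl

cancelʳ : ∀ {n} (x a : V n) → (x ⊕ a) ⊕ a ≡ x
cancelʳ = solve 2 (λ x a → (x :+ a) :+ a ⊜ x) refl

cancel-both : ∀ {n} (a x y : V n) → (a ⊕ x) ⊕ (a ⊕ y) ≡ x ⊕ y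
cancel-both = solve 3 (λ a x y → (a :+ x) :+ (a :+ y) ⊜ x :+ y) refl

_≟ᵛ_ : ∀ {n} (x y : V n) → Dec (x ≡ y)
_≟ᵛ_ = ≡-dec _≟ᵇ_

stable : ∀ {b c : Bool} → ¬ ¬ (b ≡ c) → b ≡ c
stable {b} {c} = decidable-stable (b ≟ᵇ c)

-- Since the four outcomes are decidable, the argument may be run classically with target ⊥.
by-cases : ∀ {a} (P : Set a) → (P → ⊥) → (¬ P → ⊥) → ⊥
by-cases P yes! no! = no! yes!

≢true : ∀ {b} → b ≢ true → b ≡ false
≢true = ¬-not

≢false : ∀ {b} → b ≢ false → b ≡ true
≢false = ¬-not

true≢ : ∀ {b} → b ≡ true → b ≡ false → ⊥
true≢ refl ()

split : ∀ b → b ≡ true ⊎ b ≡ false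
split true = inj₁ refl
split false = inj₂ refl

-- Subspaces and spans

record Subspace {n} (S : V n → Set) : Set where
  constructor subspace
  field
    0∈ : S 0v
    ⊕∈ : ∀ {x y} → S x → S y → S (x ⊕ y)

  ⊕∈⁻ : ∀ {x y} → S x → S (x ⊕ y) → S y
  ⊕∈⁻ {x} {y} sx sxy = subst S (cancelˡ x y) (⊕∈ sx sxy)

  ⊕∈⁻ʳ : ∀ {x y} → S y → S (x ⊕ y) → S x
  ⊕∈⁻ʳ {x} {y} sy sxy = subst S (solve 2 (λ y x → y :+ (x :+ y) ⊜ x) refl y x) (⊕∈ sy sxy)

data Span {n} (Y : V n → Set) : V n → Set where
  [] : Span Y 0v
  _∷_ : ∀ {y x} → Y y → Span Y x → Span Y (y ⊕ x)

span-⊕ : ∀ {n} {Y : V n → Set} {x y} → Span Y x → Span Y y → Span Y (x ⊕ y)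
span-⊕ {Y = Y} {y = y} [] t = subst (Span Y) (sym (⊕-identityˡ y)) t
span-⊕ {Y = Y} (g ∷ s) t = subst (Span Y) (sym (⊕-assoc _ _ _)) (g ∷ span-⊕ s t)

span-subspace : ∀ {n} (Y : V n → Set) → Subspace (Span Y)
span-subspace Y = subspace [] span-⊕

generator : ∀ {n} {Y : V n → Set} {y} → Y y → Span Y y
generator {Y = Y} {y} g = subst (Span Y) (⊕-identityʳ y) (g ∷ [])

span-⊆ : ∀ {n} {Y S : V n → Set} → Subspace S → (∀ y → Y y → S y) → ∀ {x} → Span Y x → S x
span-⊆ S≤ Y⊆S [] = Subspace.0∈ S≤
span-⊆ S≤ Y⊆S (g ∷ s) = Subspace.⊕∈ S≤ (Y⊆S _ g) (span-⊆ S≤ Y⊆S s)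

-- Walks from `x` to `x ⊕ s` one generator at a time. Typically `s` is `x` itself: if the generators
-- span `x`, the property reaches `x ⊕ x`, that is `0v`, where it fails.
translate : ∀ {n} {Y P : V n → Set} → (∀ x y → Y y → P x → P (x ⊕ y)) →
  ∀ {s} → Span Y s → ∀ x → P x → P (x ⊕ s)
translate {P = P} step [] x px = subst P (sym (⊕-identityʳ x)) px
translate {P = P} step (g ∷ s) x px = subst P (⊕-assoc x _ _) (translate step s (x ⊕ _) (step x _ g px))

module ⊻ = xor-∧-Solver

xor-regroup : ∀ a b c d → (a xor d) xor (b xor c) ≡ (a xor b) xor (c xor d)
xor-regroup = ⊻.solve 4 (λ a b c d → (a ⊻.:+ d) ⊻.:+ (b ⊻.:+ c) ⊻.:= (a ⊻.:+ b) ⊻.:+ (c ⊻.:+ d)) refl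

xor-flip-return : ∀ a b → (a xor b) xor (b xor a) ≡ false
xor-flip-return = ⊻.solve 2 (λ a b → (a ⊻.:+ b) ⊻.:+ (b ⊻.:+ a) ⊻.:= ⊻.con false) refl

xor-telescope : ∀ a b c → (a xor b) xor (b xor c) ≡ a xor c
xor-telescope = ⊻.solve 3 (λ a b c → (a ⊻.:+ b) ⊻.:+ (b ⊻.:+ c) ⊻.:= a ⊻.:+ c) refl

xor≡false : ∀ {a b} → a xor b ≡ false → a ≡ b
xor≡false {false} e = sym e
xor≡false {true} {true} e = refl

-- First, second and third differences of a Boolean function

∂ : ∀ {n} → (V n → Bool) → V n → V n → Bool
∂ f w x = f x xor f (x ⊕ w)

pol : ∀ {n} → (V n → Bool) → V n → V n → Bool
pol f x y = (f x xor f y) xor f (x ⊕ y)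

-- The sum of `f` over the seven nonempty sums of `x`, `y`, `z`, which is the third derivative at
-- `0v` when `f 0v` is false. It is grouped as a polarisation plus a second difference at `z`, so
-- that a comparison between `U` and its complement can be read off.
Δ : ∀ {n} → (V n → Bool) → V n → V n → V n → Bool
Δ f x y z = pol f x y xor (∂ f x z xor ∂ f x (z ⊕ y))

Δ-swap : ∀ {n} (f : V n → Bool) x y z → Δ f x y z ≡ Δ f x z y
Δ-swap f x y z rewrite ⊕-comm x y | ⊕-comm x z | ⊕-comm z y =
  ⊻.solve 7 (λ p q r s t v w →
    ((p ⊻.:+ q) ⊻.:+ r) ⊻.:+ ((s ⊻.:+ t) ⊻.:+ (v ⊻.:+ w)) ⊻.:=
    ((p ⊻.:+ s) ⊻.:+ t) ⊻.:+ ((q ⊻.:+ r) ⊻.:+ (v ⊻.:+ w))) refl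
    (f x) (f y) (f (y ⊕ x)) (f z) (f (z ⊕ x)) (f (y ⊕ z)) (f ((y ⊕ z) ⊕ x))

Δ-swap₁₂ : ∀ {n} (f : V n → Bool) x y z → Δ f x y z ≡ Δ f y x z
Δ-swap₁₂ f x y z rewrite ⊕-comm x y | (solve 3 (λ z y x → (z :+ y) :+ x ⊜ (z :+ x) :+ y) refl z y x) =
  ⊻.solve 7 (λ p q r s t v w →
    ((p ⊻.:+ q) ⊻.:+ r) ⊻.:+ ((s ⊻.:+ t) ⊻.:+ (v ⊻.:+ w)) ⊻.:=
    ((q ⊻.:+ p) ⊻.:+ r) ⊻.:+ ((s ⊻.:+ v) ⊻.:+ (t ⊻.:+ w))) refl
    (f x) (f y) (f (y ⊕ x)) (f z) (f (z ⊕ x)) (f (z ⊕ y)) (f ((z ⊕ x) ⊕ y))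

Δ-shift : ∀ {n} (f : V n → Bool) x y z → Δ f (x ⊕ z) y z ≡ Δ f x y z
Δ-shift f x y z
  rewrite (solve 2 (λ z x → z :+ (x :+ z) ⊜ x) refl z x) |
      (solve 3 (λ z y x → (z :+ y) :+ (x :+ z) ⊜ x :+ y) refl z y x) |
      (solve 3 (λ x z y → (x :+ z) :+ y ⊜ (z :+ y) :+ x) refl x z y) | ⊕-comm x z =
  ⊻.solve 7 (λ p q r s t v w →
    ((t ⊻.:+ q) ⊻.:+ w) ⊻.:+ ((s ⊻.:+ p) ⊻.:+ (v ⊻.:+ r)) ⊻.:=
    ((p ⊻.:+ q) ⊻.:+ r) ⊻.:+ ((s ⊻.:+ t) ⊻.:+ (v ⊻.:+ w))) refl
    (f x) (f y) (f (x ⊕ y)) (f z) (f (z ⊕ x)) (f (z ⊕ y)) (f ((z ⊕ y) ⊕ x))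

xor-interchange : ∀ a b c d → (a xor b) xor (c xor d) ≡ (a xor c) xor (b xor d)
xor-interchange = ⊻.solve 4 (λ a b c d → (a ⊻.:+ b) ⊻.:+ (c ⊻.:+ d) ⊻.:= (a ⊻.:+ c) ⊻.:+ (b ⊻.:+ d)) refl

pair-subspace : ∀ {n} (g : V n) → Subspace (λ x → x ≡ 0v ⊎ x ≡ g)
pair-subspace g = subspace (inj₁ refl) λ where
  (inj₁ refl) (inj₁ refl) → inj₁ (⊕-self 0v)
  (inj₁ refl) (inj₂ refl) → inj₂ (⊕-identityˡ g)
  (inj₂ refl) (inj₁ refl) → inj₂ (⊕-identityʳ g)
  (inj₂ refl) (inj₂ refl) → inj₁ (⊕-self g)

Adjoin : ∀ {n} → V n → (V n → Set) → V n → Set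
Adjoin g S x = S x ⊎ S (g ⊕ x)

adjoin-subspace : ∀ {n} (g : V n) {S : V n → Set} → Subspace S → Subspace (Adjoin g S)
adjoin-subspace g {S} S≤ = subspace (inj₁ S.0∈) λ where
    (inj₁ p) (inj₁ q) → inj₁ (S.⊕∈ p q)
    {x} {y} (inj₁ p) (inj₂ q) → inj₂ (subst S (solve 3 (λ x g y → x :+ (g :+ y) ⊜ g :+ (x :+ y)) refl x g y)
        (S.⊕∈ p q))
    {x} {y} (inj₂ p) (inj₁ q) → inj₂ (subst S (solve 3 (λ g x y → (g :+ x) :+ y ⊜ g :+ (x :+ y)) refl g x y)
        (S.⊕∈ p q))
    {x} {y} (inj₂ p) (inj₂ q) → inj₁ (subst S (cancel-both g x y) (S.⊕∈ p q))
  where module S = Subspace S≤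

¬¬-subspace : ∀ {n} {S : V n → Set} → Subspace S → Subspace (λ x → ¬ ¬ S x)
¬¬-subspace S≤ = subspace (λ k → k S.0∈) (λ p q k → p λ Sx → q λ Sy → k (S.⊕∈ Sx Sy))
  where module S = Subspace S≤

TriangleFreeComplement : ∀ {n} → (V n → Bool) → Set
TriangleFreeComplement f = ∀ x y → x ≢ 0v → y ≢ 0v → x ≢ y →
  f x ≡ false → f y ≡ false → f (x ⊕ y) ≡ false → ⊥

record IsPGSum {n} (f : V n → Bool) (S₁ S₂ : V n → Set) : Set where
  field
    subspace₁ : Subspace S₁
    subspace₂ : Subspace S₂
    disjoint : ∀ {x} → S₁ x → S₂ x → x ≡ 0v
    ⊆₁ : ∀ {x} → S₁ x → x ≢ 0v → f x ≡ true
    ⊆₂ : ∀ {x} → S₂ x → x ≢ 0v → f x ≡ true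
    -- The double negation is harmless: `cover` is only used to refute that a point of `E` is missed
    -- by both flats.
    cover : ∀ {x} → f x ≡ true → ¬ ¬ (S₁ x ⊎ S₂ x)

shift≢ : ∀ {n} {a u : V n} → u ≢ 0v → a ≢ a ⊕ u
shift≢ {a = a} {u} u≢0 e = u≢0 (trans (sym (cancelˡ a u)) (trans (cong (a ⊕_) (sym e)) (⊕-self a)))

⊕≢0 : ∀ {n} {a b : V n} → a ≢ b → a ⊕ b ≢ 0v
⊕≢0 {a = a} {b} a≢b e = a≢b (trans (sym (cancelʳ a b)) (trans (cong (_⊕ b) e) (⊕-identityˡ b)))

-- U = H ∪ {0} and W = F ∪ {0}; `minimal` says that no decomposer of M|H is properly contained in F.
module Core {n : ℕ} (f : V n → Bool)
  (claw : ∀ a b c → a ≢ b → a ≢ c → b ≢ c → f a ≡ true → f b ≡ true → f c ≡ true →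
     f (a ⊕ b) ≡ false → f (a ⊕ c) ≡ false → f (b ⊕ c) ≡ false → f ((a ⊕ b) ⊕ c) ≡ false → ⊥)
  (f0 : f 0v ≡ false)
  (U W : V n → Set) (U≤ : Subspace U) (W≤ : Subspace W) (W⊆U : ∀ {x} → W x → U x)
  (hyper : ∀ {x y} → ¬ U x → ¬ U y → U (x ⊕ y))
  (inv : ∀ {x w} → U x → ¬ W x → W w → f (x ⊕ w) ≡ f x)
  (w₀ : V n) (Ww₀ : W w₀) (w₀≢0 : w₀ ≢ 0v) (x₀ : V n) (Ux₀ : U x₀) (¬Wx₀ : ¬ W x₀)
  (minimal : ∀ (K : V n → Set) → Subspace K → (∀ {x} → K x → W x) → ∀ {x} → K x → x ≢ 0v →
     ∀ {w} → W w → ¬ K w → (∀ {v s} → W v → ¬ K v → K s → f (v ⊕ s) ≡ f v) → ⊥)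
  (no-decomposer : ∀ (S : V n → Set) → Subspace S → ∀ {x} → S x → x ≢ 0v → ∀ {y} → ¬ S y →
     (∀ {x s} → ¬ S x → S s → f (x ⊕ s) ≡ f x) → ⊥)
  where

  module U = Subspace U≤
  module W = Subspace W≤

  tr : ∀ {x y v} → f x ≡ v → x ≡ y → f y ≡ v
  tr h refl = h

  f⇒≢0 : ∀ {x} → f x ≡ true → x ≢ 0v
  f⇒≢0 fx refl = true≢ fx f0

  -- Cosets of `W`, and which of them are constant

  infix 4 _~_

  _~_ : V n → V n → Set
  x ~ y = W (x ⊕ y)

  ~-refl : ∀ {x} → x ~ x
  ~-refl {x} = subst W (sym (⊕-self x)) W.0∈

  ~-sym : ∀ {x y} → x ~ y → y ~ x
  ~-sym {x} {y} = subst W (⊕-comm x y)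

  ~-trans : ∀ {x y z} → x ~ y → y ~ z → x ~ z
  ~-trans {x} {y} {z} p q = subst W (solve 3 (λ x y z → (x :+ y) :+ (y :+ z) ⊜ x :+ z) refl x y z) (W.⊕∈ p q)

  ~-shift : ∀ {x y w} → x ~ y → W w → x ~ y ⊕ w
  ~-shift {x} {y} {w} p q = subst W (⊕-assoc x y w) (W.⊕∈ p q)

  ≁⇒≢ : ∀ {x y} → ¬ x ~ y → x ≢ y
  ≁⇒≢ x≁y refl = x≁y ~-refl

  ¬U-⊕ : ∀ {a x} → ¬ U a → U x → ¬ U (a ⊕ x)
  ¬U-⊕ ¬Ua Ux Uax = ¬Ua (U.⊕∈⁻ʳ Ux Uax)

  ¬U-~ : ∀ {a b} → ¬ U a → a ~ b → ¬ U b
  ¬U-~ ¬Ua a~b Ub = ¬Ua (U.⊕∈⁻ʳ Ub (W⊆U a~b))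

  inv~ : ∀ {x y} → U x → ¬ W x → x ~ y → f y ≡ f x
  inv~ {x} {y} Ux ¬Wx x~y = tr (inv Ux ¬Wx x~y) (cancelˡ x y)

  -- The sum of two points off `U` lies in `U`, and off `W` when their cosets differ, so `inv~`
  -- applies. Hence representatives of cosets can be exchanged without disturbing the values on
  -- lines in a claw.
  line : ∀ {a b a′ b′} → ¬ U a → ¬ U b → ¬ a ~ b → a ~ a′ → b ~ b′ → f (a′ ⊕ b′) ≡ f (a ⊕ b)
  line {a} {b} {a′} {b′} ¬Ua ¬Ub a≁b a~a′ b~b′ =
    inv~ (hyper ¬Ua ¬Ub) a≁b (subst W (interchange a a′ b b′) (W.⊕∈ a~a′ b~b′))

  Constant N : V n → Set
  Constant a = ∀ b → a ~ b → f b ≡ f a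
  N a = ¬ U a × ¬ Constant a

  constant-~ : ∀ {a b} → a ~ b → Constant a → Constant b
  constant-~ a~b ca c b~c = trans (ca c (~-trans a~b b~c)) (sym (ca _ a~b))

  N-~ : ∀ {a b} → a ~ b → N a → N b
  N-~ a~b (¬Ua , ¬ca) = ¬U-~ ¬Ua a~b , λ cb → ¬ca (constant-~ (~-sym a~b) cb)

  N≁constant : ∀ {a b} → N a → Constant b → ¬ a ~ b
  N≁constant (_ , ¬ca) cb a~b = ¬ca (constant-~ (~-sym a~b) cb)

  constant-⊕ : ∀ {a w v} → Constant a → W w → f a ≡ v → f (a ⊕ w) ≡ v
  constant-⊕ ca Ww fa = trans (ca _ (~-shift ~-refl Ww)) fa

  pick : ∀ {a} → N a → ∀ v → (∀ b → a ~ b → f b ≡ v → ⊥) → ⊥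
  pick (_ , ¬ca) v k = ¬ca λ b a~b → trans (¬-not (k b a~b)) (sym (¬-not (k _ ~-refl)))

  -- Stabilisers, and the claws that constrain them

  K : V n → V n → Set
  K a k = W k × (∀ b → a ~ b → f (b ⊕ k) ≡ f b)

  K-subspace : ∀ a → Subspace (K a)
  K-subspace a = subspace (W.0∈ , λ b _ → cong f (⊕-identityʳ b))
    λ { {k} {l} (Wk , ik) (Wl , il) → W.⊕∈ Wk Wl , λ b a~b →
        trans (cong f (sym (⊕-assoc b k l))) (trans (il _ (~-shift a~b Wk)) (ik b a~b)) }

  module K (a : V n) = Subspace (K-subspace a)

  -- Excluding drops from true to false suffices: `u` is its own inverse, so a rise at `b` is a drop
  -- at `b ⊕ u`.
  K-intro : ∀ {a u} → W u → (∀ b → a ~ b → f b ≡ true → f (b ⊕ u) ≡ false → ⊥) → K a u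
  K-intro {a} {u} Wu h = Wu , λ b a~b → stable λ ne → case split (f b) of λ where
    (inj₁ t) → h b a~b t (≢true (λ t′ → ne (trans t′ (sym t))))
    (inj₂ e) → h (b ⊕ u) (~-shift a~b Wu) (≢false (λ e′ → ne (trans e′ (sym e)))) (tr e (sym (cancelʳ b u)))

  ¬K-elim : ∀ {a u} → W u → ¬ K a u → (∀ b → a ~ b → f b ≡ true → f (b ⊕ u) ≡ false → ⊥) → ⊥
  ¬K-elim Wu ¬Ku h = ¬Ku (K-intro Wu h)

  K-⊕ : ∀ {a k b v} → K a k → a ~ b → f b ≡ v → f (b ⊕ k) ≡ v
  K-⊕ (_ , ik) a~b fb = trans (ik _ a~b) fb

  ¬K⇒≢0 : ∀ {a u} → ¬ K a u → u ≢ 0v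
  ¬K⇒≢0 {a} ¬Ku refl = ¬Ku (K.0∈ a)

  moved⇒≢0 : ∀ {b u} → f b ≡ true → f (b ⊕ u) ≡ false → u ≢ 0v
  moved⇒≢0 {b} t e refl = true≢ t (tr e (⊕-identityʳ b))

  K-proper : ∀ {a} → N a → (∀ w → W w → ¬ K a w → ⊥) → ⊥
  K-proper {a} (_ , ¬ca) h = ¬ca λ b a~b → stable λ ne →
    h (a ⊕ b) a~b (λ { (_ , ik) → ne (tr (ik a ~-refl) (cancelˡ a b)) })

  -- The names count the ones of f on {a, a + u, b, b + u}.
  claw-three : ∀ {a b u} → ¬ U a → ¬ U b → ¬ a ~ b → W u → u ≢ 0v → f u ≡ false → f (a ⊕ b) ≡ false →
    f b ≡ true → f (b ⊕ u) ≡ false → f a ≡ true → f (a ⊕ u) ≡ true → ⊥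
  claw-three {a} {b} {u} ¬Ua ¬Ub a≁b Wu u≢0 fu fab fb fbu fa fau =
    claw b a (a ⊕ u) (≁⇒≢ (a≁b ∘ ~-sym))
      (≁⇒≢ (λ h → a≁b (~-sym (~-trans (~-shift h Wu) (subst (_~ a) (sym (cancelʳ a u)) ~-refl)))))
      (shift≢ u≢0) fb fa fau
      (tr fab (⊕-comm a b))
      (tr (trans (inv (hyper ¬Ua ¬Ub) a≁b Wu) fab)
          (solve 3 (λ a b u → (a :+ b) :+ u ⊜ b :+ (a :+ u)) refl a b u))
      (tr fu (sym (cancelˡ a u)))
      (tr fbu (solve 3 (λ b u a → b :+ u ⊜ (b :+ a) :+ (a :+ u)) refl b u a))

  claw-one : ∀ {a b u} → ¬ U a → ¬ U b → ¬ a ~ b → W u → u ≢ 0v → f u ≡ false → f (a ⊕ b) ≡ true →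
    f b ≡ true → f (b ⊕ u) ≡ false → f a ≡ false → f (a ⊕ u) ≡ false → ⊥
  claw-one {a} {b} {u} ¬Ua ¬Ub a≁b Wu u≢0 fu fab fb fbu fa fau =
    claw b (a ⊕ b) ((a ⊕ b) ⊕ u)
      (λ e → ¬Ub (subst U (sym e) Uab)) (λ e → ¬Ub (subst U (sym e) (U.⊕∈ Uab (W⊆U Wu))))
      (shift≢ u≢0) fb fab (trans (inv Uab a≁b Wu) fab)
      (tr fa (solve 2 (λ a b → a ⊜ b :+ (a :+ b)) refl a b))
      (tr fau (solve 3 (λ a u b → a :+ u ⊜ b :+ ((a :+ b) :+ u)) refl a u b))
      (tr fu (sym (cancelˡ (a ⊕ b) u)))
      (tr fbu (solve 3 (λ b u a → b :+ u ⊜ (b :+ (a :+ b)) :+ ((a :+ b) :+ u)) refl b u a))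
    where Uab = hyper ¬Ua ¬Ub

  claw-two : ∀ {a b u} → ¬ U a → ¬ U b → ¬ a ~ b → W u → f u ≡ true → f (a ⊕ b) ≡ false →
    f b ≡ true → f (b ⊕ u) ≡ false → f a ≡ true → f (a ⊕ u) ≡ false → ⊥
  claw-two {a} {b} {u} ¬Ua ¬Ub a≁b Wu fu fab fb fbu fa fau =
    claw u a b (λ e → ¬Ua (subst U e (W⊆U Wu))) (λ e → ¬Ub (subst U e (W⊆U Wu))) (≁⇒≢ a≁b)
      fu fa fb (tr fau (⊕-comm a u)) (tr fbu (⊕-comm b u)) fab
      (tr (trans (inv (hyper ¬Ua ¬Ub) a≁b Wu) fab)
          (solve 3 (λ a b u → (a :+ b) :+ u ⊜ (u :+ a) :+ b) refl a b u))

  -- The decomposer is the span of L and a.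
  decompose : ∀ (L : V n → Set) → Subspace L → (∀ {x} → L x → U x) → ∀ {a} → ¬ U a →
    (∀ {x l} → U x → ¬ L x → L l → f (x ⊕ l) ≡ f x) →
    (∀ {x} → U x → ¬ L x → f (a ⊕ x) ≡ f x) → ∀ {x} → U x → ¬ L x → ⊥
  decompose L L≤ L⊆U {a} ¬Ua inL ina Ux ¬Lx =
    no-decomposer (Adjoin a L) (adjoin-subspace a L≤) {a} (inj₂ (subst L (sym (⊕-self a)) L.0∈))
        (λ { refl → ¬Ua U.0∈ })
      (λ { (inj₁ Lx) → ¬Lx Lx ; (inj₂ Lax) → ¬Ua (U.⊕∈⁻ʳ Ux (L⊆U Lax)) }) invS
    where
    module L = Subspace L≤
    S : V n → Set
    S = Adjoin a L
    in-U : ∀ {x s} → U x → ¬ S x → S s → f (x ⊕ s) ≡ f x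
    in-U Ux ¬Sx (inj₁ Ls) = inL Ux (¬Sx ∘ inj₁) Ls
    in-U {x} {s} Ux ¬Sx (inj₂ Las) = trans
      (cong f (solve 3 (λ x s a → x :+ s ⊜ a :+ (x :+ (a :+ s))) refl x s a))
      (trans (ina (U.⊕∈ Ux (L⊆U Las)) (λ h → ¬Sx (inj₁ (L.⊕∈⁻ʳ Las h)))) (inL Ux (¬Sx ∘ inj₁) Las))
    off-U : ∀ {x s} → ¬ U x → ¬ S x → S s → f (x ⊕ s) ≡ f x
    off-U {x} {s} ¬Ux ¬Sx Ss = trans (cong f (sym (cancel-both a x s)))
      (trans (in-U Uax ¬Sax (swap Ss)) (trans (sym (ina Uax (¬Sx ∘ inj₂))) (cong f (cancelˡ a x))))
      where
      Uax = hyper ¬Ua ¬Ux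
      ¬Sax : ¬ S (a ⊕ x)
      ¬Sax (inj₁ p) = ¬Sx (inj₂ p)
      ¬Sax (inj₂ p) = ¬Sx (inj₁ (subst L (cancelˡ a x) p))
      swap : ∀ {s} → S s → S (a ⊕ s)
      swap {s} (inj₁ p) = inj₂ (subst L (sym (cancelˡ a s)) p)
      swap (inj₂ p) = inj₁ p
    invS : ∀ {x s} → ¬ S x → S s → f (x ⊕ s) ≡ f x
    invS {x} ¬Sx Ss = stable λ ne → by-cases (U x) (λ Ux → ne (in-U Ux ¬Sx Ss)) (λ ¬Ux → ne (off-U ¬Ux ¬Sx Ss))

  module _ {z : V n} (Wz : W z) (z≢0 : z ≢ 0v) (fz : f z ≡ false) where

    -- Otherwise K a contains every zero of f on W, and their span is a smaller decomposer.
    constant-value : ∀ {a b} → N a → ¬ U b → Constant b → f b ≡ f (a ⊕ b)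
    constant-value {a} {b} Na@(¬Ua , _) ¬Ub cb = stable λ ne → K-proper Na λ w Ww ¬Kw →
      minimal κ (span-subspace Z) (λ s → proj₁ (κ⊆K ne s)) (generator (Wz , fz)) z≢0 Ww (¬Kw ∘ κ⊆K ne)
        λ {v} {s} Wv ¬κv κs → trans
          (one (W.⊕∈ Wv (proj₁ (κ⊆K ne κs))) (λ h → ¬κv (Subspace.⊕∈⁻ʳ (span-subspace Z) κs h)))
          (sym (one Wv ¬κv))
      where
      Z κ : V n → Set
      Z u = W u × f u ≡ false
      κ = Span Z
      -- All zeros of `f` on `W` lie in `κ`, so `f` is constantly true on the rest of `W`, which
      -- adding an element of `κ` does not leave.
      one : ∀ {v} → W v → ¬ κ v → f v ≡ true
      one Wv ¬κv = ≢false λ fv → ¬κv (generator (Wv , fv))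
      b≁a : ¬ b ~ a
      b≁a = N≁constant Na cb ∘ ~-sym
      Z⊆K : f b ≢ f (a ⊕ b) → ∀ u → Z u → K a u
      Z⊆K ne u (Wu , fu) = K-intro Wu λ c a~c fc fcu →
        let ¬Uc = ¬U-~ ¬Ua a~c
            b≁c = λ b~c → b≁a (~-trans b~c (~-sym a~c))
            fbc : ∀ {v} → f (a ⊕ b) ≡ v → f (b ⊕ c) ≡ v
            fbc h = trans (line ¬Ub ¬Ua b≁a ~-refl a~c) (tr h (⊕-comm a b))
        in case split (f b) of λ where
          (inj₁ t) → claw-three ¬Ub ¬Uc b≁c Wu (moved⇒≢0 fc fcu) fu
            (fbc (≢true (λ t′ → ne (trans t (sym t′))))) fc fcu t (constant-⊕ cb Wu t)
          (inj₂ e) → claw-one ¬Ub ¬Uc b≁c Wu (moved⇒≢0 fc fcu) fu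
            (fbc (≢false (λ e′ → ne (trans e (sym e′))))) fc fcu e (constant-⊕ cb Wu e)
      κ⊆K : f b ≢ f (a ⊕ b) → ∀ {u} → κ u → K a u
      κ⊆K ne = span-⊆ (K-subspace a) (Z⊆K ne)

  NoZeroPair : V n → Set
  NoZeroPair a = ∀ {u b} → W u → u ≢ 0v → f u ≡ false → a ~ b → f b ≡ false → f (b ⊕ u) ≡ false → ⊥

  -- A zero pair in direction u puts u into K a; the span of all such zeros u of f is a smaller decomposer.
  no-zero-pair : ∀ {a b} → N a → N b → ¬ a ~ b → f (a ⊕ b) ≡ true → NoZeroPair a
  no-zero-pair {a} {b} Na@(¬Ua , _) Nb@(¬Ub , _) a≁b fab {u} {a₁} Wu u≢0 fu a~a₁ fa₁ fa₁u =
    K-proper Na λ w Ww ¬Kw →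
      minimal κ (span-subspace Gen) (proj₁ ∘ κ⊆K)
        (generator (Wu , fu , zero-pair⇒K Wu u≢0 fu a~a₁ fa₁ fa₁u)) u≢0 Ww (¬Kw ∘ κ⊆K)
        λ {v} {s} Wv ¬κv κs → proj₂ (proj₂ (translate {P = λ x → W x × ¬ κ x × f x ≡ f v}
          (λ { x y g (Wx , ¬κx , e) → W.⊕∈ Wx (proj₁ g) , (λ h → ¬κx (κ.⊕∈⁻ʳ (generator g) h)) ,
               trans (step Wx ¬κx g) e })
          κs v (Wv , ¬κv , refl)))
    where
    -- The zero pair at `a` forces `u` into `K b`. A zero of `b + W` then forms a zero pair with its
    -- translate by `u`, and the same claw with the cosets exchanged puts `u` in `K a`.
    zero-pair⇒K : ∀ {u c} → W u → u ≢ 0v → f u ≡ false → a ~ c → f c ≡ false → f (c ⊕ u) ≡ false → K a u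
    zero-pair⇒K {u} {c} Wu u≢0 fu a~c fc fcu = K-intro Wu λ a₂ a~a₂ fa₂ fa₂u →
      pick Nb false λ b₂ b~b₂ fb₂ →
        claw-one (¬U-~ ¬Ub b~b₂) (¬U-~ ¬Ua a~a₂)
          (λ h → a≁b (~-trans a~a₂ (~-trans (~-sym h) (~-sym b~b₂)))) Wu u≢0 fu
          (trans (line ¬Ub ¬Ua (a≁b ∘ ~-sym) b~b₂ a~a₂) (tr fab (⊕-comm a b)))
          fa₂ fa₂u fb₂ (K-⊕ Kbu b~b₂ fb₂)
      where
      Kbu : K b u
      Kbu = K-intro Wu λ b₂ b~b₂ fb₂ fb₂u →
        claw-one (¬U-~ ¬Ua a~c) (¬U-~ ¬Ub b~b₂)
          (λ h → a≁b (~-trans a~c (~-trans h (~-sym b~b₂)))) Wu u≢0 fu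
          (trans (line ¬Ua ¬Ub a≁b a~c b~b₂) fab) fb₂ fb₂u fc fcu
    Gen κ : V n → Set
    Gen k = W k × f k ≡ false × K a k
    κ = Span Gen
    module κ = Subspace (span-subspace Gen)
    κ⊆K : ∀ {x} → κ x → K a x
    κ⊆K = span-⊆ (K-subspace a) (λ _ g → proj₂ (proj₂ g))
    half : ∀ {v k} → W v → ¬ κ v → Gen k → f v ≡ false → f (v ⊕ k) ≡ true → ⊥
    half {v} {k} Wv ¬κv (Wk , fk , Kk) fv fvk = by-cases (K a v)
      (λ Kv → ¬κv (generator (Wv , fv , Kv)))
      -- Both `c` and `c ⊕ k` are zeros. If adding `v` to either gave a zero again, `v` would be the
      -- direction of a zero pair and lie in `K a`; so both translates are ones, and they complete a
      -- claw with `v ⊕ k`.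
      λ ¬Kv → pick Na false λ c a~c fc →
        let v≢0 = λ { refl → ¬κv κ.0∈ }
            fck = K-⊕ Kk a~c fc
            a~ck = ~-shift a~c Wk
            ¬Ucv = ¬U-⊕ (¬U-~ ¬Ua a~c) (W⊆U Wv)
            ¬Uckv = ¬U-⊕ (¬U-~ ¬Ua a~ck) (W⊆U Wv)
            Uvk = U.⊕∈ (W⊆U Wv) (W⊆U Wk)
            k≢0 : k ≢ 0v
            k≢0 = λ { refl → true≢ fvk (tr fv (sym (⊕-identityʳ v))) }
        in claw (v ⊕ k) (c ⊕ v) ((c ⊕ k) ⊕ v)
          (λ e → ¬Ucv (subst U e Uvk)) (λ e → ¬Uckv (subst U e Uvk))
          (λ e → shift≢ {a = c ⊕ v} k≢0 (trans e
              (solve 3 (λ c k v → (c :+ k) :+ v ⊜ (c :+ v) :+ k) refl c k v)))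
          fvk (≢false (λ e → ¬Kv (zero-pair⇒K Wv v≢0 fv a~c fc e)))
          (≢false (λ e → ¬Kv (zero-pair⇒K Wv v≢0 fv a~ck fck e)))
          (tr fck (solve 3 (λ c k v → c :+ k ⊜ (v :+ k) :+ (c :+ v)) refl c k v))
              (tr fc (solve 3 (λ c v k → c ⊜ (v :+ k) :+ ((c :+ k) :+ v)) refl c v k))
          (tr fk (solve 3 (λ k c v → k ⊜ (c :+ v) :+ ((c :+ k) :+ v)) refl k c v))
          (tr fv (solve 3 (λ v k c → v ⊜ ((v :+ k) :+ (c :+ v)) :+ ((c :+ k) :+ v)) refl v k c))
    step : ∀ {v k} → W v → ¬ κ v → Gen k → f (v ⊕ k) ≡ f v
    step {v} {k} Wv ¬κv g@(Wk , _) = stable λ ne → case split (f v) of λ where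
      (inj₁ t) → half (W.⊕∈ Wv Wk) (λ h → ¬κv (κ.⊕∈⁻ʳ (generator g) h)) g
        (≢true (λ t′ → ne (trans t′ (sym t)))) (tr t (sym (cancelʳ v k)))
      (inj₂ e) → half Wv ¬κv g e (≢false (λ e′ → ne (trans e′ (sym e))))

  -- Two nonconstant cosets whose sum has value false

  record ZeroPair (a b : V n) : Set where
    constructor zero-pair
    field
      Na : N a
      Nb : N b
      a≁b : ¬ a ~ b
      fab : f (a ⊕ b) ≡ false

    ¬Ua = proj₁ Na
    ¬Ub = proj₁ Nb

  zero-pair-sym : ∀ {a b} → ZeroPair a b → ZeroPair b a
  zero-pair-sym {a} {b} (zero-pair Na Nb a≁b fab) = zero-pair Nb Na (a≁b ∘ ~-sym) (tr fab (⊕-comm a b))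

  module _ {a b} (p : ZeroPair a b) where
    open ZeroPair p

    -- A one of `a + W` stays a one under `u`, while some one of `b + W` does not; `claw-three`
    -- forbids this when `f u` is false.
    K∖K⇒true : ∀ {u} → K a u → ¬ K b u → f u ≡ true
    K∖K⇒true {u} Ku ¬Ku = ≢false λ fu → ¬K-elim (proj₁ Ku) ¬Ku λ c b~c fc fcu →
      pick Na true λ d a~d fd →
        claw-three (¬U-~ ¬Ua a~d) (¬U-~ ¬Ub b~c) (λ h → a≁b (~-trans a~d (~-trans h (~-sym b~c))))
          (proj₁ Ku) (moved⇒≢0 fc fcu) fu (trans (line ¬Ua ¬Ub a≁b a~d b~c) fab)
          fc fcu fd (K-⊕ Ku a~d fd)

    -- Each of the two cosets has a one that `u` turns into a zero, which `claw-two` forbids when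
    -- `f u` is true. With `K∖K⇒true`, taken in both orders, this determines `f` on `W` outside the
    -- intersection of `K a` and `K b`.
    outside⇒false : ∀ {u} → W u → ¬ K a u → ¬ K b u → f u ≡ false
    outside⇒false Wu ¬Kau ¬Kbu = ≢true λ fu →
      ¬K-elim Wu ¬Kau λ d a~d fd fdu → ¬K-elim Wu ¬Kbu λ c b~c fc fcu →
        claw-two (¬U-~ ¬Ua a~d) (¬U-~ ¬Ub b~c) (λ h → a≁b (~-trans a~d (~-trans h (~-sym b~c))))
          Wu fu (trans (line ¬Ua ¬Ub a≁b a~d b~c) fab) fc fcu fd fdu

    no-one-pair : ∀ {u d} → W u → ¬ K a u → ¬ K b u → a ~ d → f d ≡ true → f (d ⊕ u) ≡ true → ⊥
    no-one-pair Wu ¬Kau ¬Kbu a~d fd fdu = ¬K-elim Wu ¬Kbu λ c b~c fc fcu →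
      claw-three (¬U-~ ¬Ua a~d) (¬U-~ ¬Ub b~c) (λ h → a≁b (~-trans a~d (~-trans h (~-sym b~c))))
        Wu (moved⇒≢0 fc fcu) (outside⇒false Wu ¬Kau ¬Kbu)
        (trans (line ¬Ua ¬Ub a≁b a~d b~c) fab) fc fcu fd fdu

  -- Off the intersection, `f` on `W` depends only on membership in `K a` and in `K b`, and adding
  -- an element of the intersection changes neither. A nonzero intersection would therefore be a
  -- smaller decomposer.
  K∩K-trivial : ∀ {a b} → ZeroPair a b → ∀ {x} → K a x → K b x → x ≢ 0v → ⊥
  K∩K-trivial {a} {b} p {x} Kax Kbx x≢0 = K-proper Na λ w Ww ¬Kaw →
    minimal (λ x → K a x × K b x)
      (subspace (K.0∈ a , K.0∈ b) (λ (k , l) (k′ , l′) → K.⊕∈ a k k′ , K.⊕∈ b l l′))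
      (λ (k , _) → proj₁ k) (Kax , Kbx) x≢0 Ww (λ (k , _) → ¬Kaw k)
      λ {v} {s} Wv ¬J (Kas , Kbs) → stable λ ne → by-cases (K a v)
        (λ Kav → ne (trans
          (K∖K⇒true p (K.⊕∈ a Kav Kas) (λ h → ¬J (Kav , K.⊕∈⁻ʳ b Kbs h)))
          (sym (K∖K⇒true p Kav (λ h → ¬J (Kav , h))))))
        λ ¬Kav → by-cases (K b v)
          (λ Kbv → ne (trans
            (K∖K⇒true (zero-pair-sym p) (K.⊕∈ b Kbv Kbs) (λ h → ¬Kav (K.⊕∈⁻ʳ a Kas h)))
            (sym (K∖K⇒true (zero-pair-sym p) Kbv ¬Kav))))
          λ ¬Kbv → ne (trans
            (outside⇒false p (W.⊕∈ Wv (proj₁ Kas))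
              (λ h → ¬Kav (K.⊕∈⁻ʳ a Kas h)) (λ h → ¬Kbv (K.⊕∈⁻ʳ b Kbs h)))
            (sym (outside⇒false p Wv ¬Kav ¬Kbv)))
    where open ZeroPair p

  module _ {o : V n} (Wo : W o) (fo : f o ≡ true) where

    -- If K a ⊆ K b, then K a = 0 and f vanishes on W exactly off K b, so K b is a smaller decomposer.
    K⊈K : ∀ {a b} → ZeroPair a b → (∀ k → K a k → ¬ K b k → ⊥) → ⊥
    K⊈K {a} {b} p h = by-cases (K b o)
      (λ Kbo → K-proper Nb λ w Ww ¬Kw →
        minimal (K b) (K-subspace b) proj₁ Kbo (f⇒≢0 fo) Ww ¬Kw
          λ Wv ¬Kv Ks → trans (zeros (W.⊕∈ Wv (proj₁ Ks)) (λ k → ¬Kv (K.⊕∈⁻ʳ b Ks k))) (sym (zeros Wv ¬Kv)))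
      (λ ¬Kbo → true≢ fo (zeros Wo ¬Kbo))
      where
      open ZeroPair p
      zeros : ∀ {v} → W v → ¬ K b v → f v ≡ false
      zeros Wv ¬Kbv = outside⇒false p Wv
        (λ Kav → h _ Kav ¬Kbv) ¬Kbv

    -- So the ones of `f` on `a + W` form a single coset of `K a`. If `d` lies in `K b`, some `k` in
    -- `K a` off `K b` makes `d ⊕ k` avoid both stabilisers while it still joins two ones.
    ones-coset : ∀ {a b} → ZeroPair a b → ∀ {d c} → W d → a ~ c → f c ≡ true → f (c ⊕ d) ≡ true → ¬ ¬ K a d
    ones-coset {a} {b} p {d} {c} Wd a~c fc fcd ¬Kad = by-cases (K b d)
      (λ Kbd → K⊈K p λ k Kak ¬Kbk → no-one-pair p (W.⊕∈ Wd (proj₁ Kak))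
        (λ h → ¬Kad (K.⊕∈⁻ʳ a Kak h)) (λ h → ¬Kbk (K.⊕∈⁻ b Kbd h)) a~c fc
        (tr (K-⊕ Kak (~-shift a~c Wd) fcd) (⊕-assoc c d k)))
      (λ ¬Kbd → no-one-pair p Wd ¬Kad ¬Kbd a~c fc fcd)

    -- A one `c` of `a + W` has zeros at `c ⊕ l` and `c ⊕ l′`, hence also at `(c ⊕ l′) ⊕ k`. The
    -- difference `(l ⊕ l′) ⊕ k` of two of these avoids both stabilisers, so it is a zero of `f`,
    -- against `NoZeroPair a`. Thus `K b` has at most one nonzero element.
    K-singleton : ∀ {a b} → ZeroPair a b → NoZeroPair a → ∀ {k l l′} → K a k → ¬ K b k →
      K b l → l ≢ 0v → K b l′ → l′ ≢ 0v → l ≢ l′ → ⊥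
    K-singleton {a} {b} p T {k} {l} {l′} Kak ¬Kbk Kbl l≢0 Kbl′ l′≢0 l≢l′ = pick Na true λ c a~c fc →
      let zero-at : ∀ {m} → K b m → m ≢ 0v → f (c ⊕ m) ≡ false
          zero-at Kbm m≢0 = ≢true λ t →
            ones-coset p (proj₁ Kbm) a~c fc t (λ Kam → K∩K-trivial p Kam Kbm m≢0)
          Wu = W.⊕∈ (W.⊕∈ (proj₁ Kbl) (proj₁ Kbl′)) (proj₁ Kak)
          ¬Kau = λ h → K∩K-trivial p (K.⊕∈⁻ʳ a Kak h) (K.⊕∈ b Kbl Kbl′) (⊕≢0 l≢l′)
          ¬Kbu = λ h → ¬Kbk (K.⊕∈⁻ b (K.⊕∈ b Kbl Kbl′) h)
      in T Wu (¬K⇒≢0 ¬Kau) (outside⇒false p Wu ¬Kau ¬Kbu) (~-shift a~c (proj₁ Kbl)) (zero-at Kbl l≢0)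
           (tr (K-⊕ Kak (~-shift a~c (proj₁ Kbl′)) (zero-at Kbl′ l′≢0))
             (solve 4 (λ c l′ k l → (c :+ l′) :+ k ⊜ (c :+ l) :+ ((l :+ l′) :+ k)) refl c l′ k l))
      where open ZeroPair p

    -- Here K a = {0, k} and K b = {0, l}, so {k + l} is a smaller decomposer.
    zero-pair-without-00 : ∀ {a b} → ZeroPair a b → NoZeroPair a → NoZeroPair b → ⊥
    zero-pair-without-00 {a} {b} p Ta Tb =
      K⊈K p λ k Kak ¬Kbk → K⊈K (zero-pair-sym p) λ l Kbl ¬Kal → contra Kak ¬Kbk Kbl ¬Kal
      where
      contra : ∀ {k l} → K a k → ¬ K b k → K b l → ¬ K a l → ⊥
      contra {k} {l} Kak ¬Kbk Kbl ¬Kal =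
        minimal (λ x → x ≡ 0v ⊎ x ≡ k ⊕ l) (pair-subspace (k ⊕ l))
          (λ { (inj₁ refl) → W.0∈ ; (inj₂ refl) → W.⊕∈ (proj₁ Kak) (proj₁ Kbl) })
          (inj₂ refl) (⊕≢0 (λ { refl → ¬Kbk Kbl }))
          (proj₁ Kak) (λ { (inj₁ e) → ¬K⇒≢0 ¬Kbk e ; (inj₂ e) → shift≢ (¬K⇒≢0 ¬Kal) e })
          λ where
            Wv ¬Pv (inj₁ refl) → cong f (⊕-identityʳ _)
            {v} Wv ¬Pv (inj₂ refl) → case split (f v) of λ where
              (inj₁ t) → trans (ones Wv ¬Pv t) (sym t)
              (inj₂ e) → trans (≢true (λ t → true≢ (tr
                (ones (W.⊕∈ Wv (W.⊕∈ (proj₁ Kak) (proj₁ Kbl))) (λ h → ¬Pv (P.⊕∈⁻ʳ (inj₂ refl) h)) t)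
                (cancelʳ v (k ⊕ l))) e)) (sym e)
        where
        module P = Subspace (pair-subspace (k ⊕ l))
        ones : ∀ {v} → W v → ¬ (v ≡ 0v ⊎ v ≡ k ⊕ l) → f v ≡ true → f (v ⊕ (k ⊕ l)) ≡ true
        -- A one of `f` on `W` lies in `K a` or `K b`, so by `K-singleton` it is `k` or `l`, and
        -- `k ⊕ l` exchanges these two.
        ones {v} Wv ¬Pv fv = stable λ ne → by-cases (K a v)
          (λ Kav → K-singleton (zero-pair-sym p) Tb Kbl ¬Kal Kak (¬K⇒≢0 ¬Kbk) Kav (¬Pv ∘ inj₁)
            λ { refl → ne (tr (K∖K⇒true (zero-pair-sym p) Kbl ¬Kal) (sym (cancelˡ k l))) })
          λ ¬Kav → by-cases (K b v)
            (λ Kbv → K-singleton p Ta Kak ¬Kbk Kbl (¬K⇒≢0 ¬Kal) Kbv (¬Pv ∘ inj₁)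
              λ { refl → ne (tr (K∖K⇒true p Kak ¬Kbk) (solve 2 (λ k l → k ⊜ l :+ (k :+ l)) refl k l)) })
            λ ¬Kbv → true≢ fv (outside⇒false p Wv ¬Kav ¬Kbv)

    module _ {z : V n} (Wz : W z) (z≢0 : z ≢ 0v) (fz : f z ≡ false) where

      -- Both the constant and the nonconstant case for the coset of a + b + c are contradictory.
      fourth : ∀ {a b c} → ZeroPair a b → N c → ¬ a ~ c → ¬ b ~ c → f (a ⊕ c) ≡ false → f (b ⊕ c) ≡ true → ⊥
      fourth {a} {b} {c} p Nc a≁c b≁c fac fbc = by-cases (Constant d)
          (λ cd → true≢ (trans (constant-value Wz z≢0 fz Na ¬Ud cd) fad)
            (trans (constant-value Wz z≢0 fz Nb ¬Ud cd)
                (tr fac (solve 3 (λ a c b → a :+ c ⊜ b :+ ((a :+ b) :+ c)) refl a c b))))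
          (λ ¬cd → zero-pair-without-00 p
            (no-zero-pair Na (¬Ud , ¬cd) (λ h → b≁c
                (subst W (solve 3 (λ a b c → a :+ ((a :+ b) :+ c) ⊜ b :+ c) refl a b c) h)) fad)
            (no-zero-pair Nb Nc b≁c fbc))
        where
        open ZeroPair p
        d = (a ⊕ b) ⊕ c
        ¬Ud : ¬ U d
        ¬Ud h = proj₁ Nc (U.⊕∈⁻ (hyper ¬Ua ¬Ub) h)
        fad : f (a ⊕ d) ≡ true
        fad = tr fbc (solve 3 (λ b c a → b :+ c ⊜ a :+ ((a :+ b) :+ c)) refl b c a)

      no-third : ∀ {a b c} → ZeroPair a b → N c → ¬ a ~ c → ¬ b ~ c → ⊥
      no-third {a} {b} {c} p Nc a≁c b≁c = case (split (f (a ⊕ c)) , split (f (b ⊕ c))) of λ where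
          (inj₁ t , inj₁ t′) → zero-pair-without-00 p (no-zero-pair Na Nc a≁c t) (no-zero-pair Nb Nc b≁c t′)
          -- For `k` in `K a` off `K b`, the pair `a`, `b` makes `f k` true. The pair `a`, `c` keeps
          -- `k` out of `K c`, and then the pair `b`, `c` makes `f k` false.
          (inj₂ e , inj₂ e′) → K⊈K p λ k Kak ¬Kbk → by-cases (K c k)
            (λ Kck → K∩K-trivial (zero-pair Na Nc a≁c e) Kak Kck (¬K⇒≢0 ¬Kbk))
            (λ ¬Kck → true≢ (K∖K⇒true p Kak ¬Kbk)
              (outside⇒false (zero-pair Nb Nc b≁c e′) (proj₁ Kak) ¬Kbk ¬Kck))
          (inj₂ e , inj₁ t) → fourth p Nc a≁c b≁c e t
          (inj₁ t , inj₂ e) → fourth (zero-pair-sym p) Nc b≁c a≁c e t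
        where
        open ZeroPair p

      pg-sum : ∀ {a b} → ZeroPair a b → Σ (V n → Set) λ S₁ → Σ (V n → Set) (IsPGSum f S₁)
      pg-sum {a} {b} p = S a , S b , record
        { subspace₁ = S≤ p ; subspace₂ = S≤ (zero-pair-sym p) ; disjoint = disjoint
        ; ⊆₁ = S⊆ p ; ⊆₂ = S⊆ (zero-pair-sym p) ; cover = cover }
        where
        open ZeroPair p
        S : V n → V n → Set
        -- The ones of `a + W` are a coset of `K a` by `ones-coset`, so adjoining them to `K a`
        -- gives a subspace.
        S a x = K a x ⊎ (a ~ x × f x ≡ true)
        S≤ : ∀ {a b} → ZeroPair a b → Subspace (S a)
        S≤ {a} p = subspace (inj₁ (K.0∈ a)) λ where
          (inj₁ k) (inj₁ l) → inj₁ (K.⊕∈ a k l)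
          {x} {y} (inj₁ k) (inj₂ (a~y , fy)) → inj₂
            ( subst W (solve 3 (λ a y x → a :+ (y :+ x) ⊜ a :+ (x :+ y)) refl a y x) (~-shift a~y (proj₁ k)) ,
                tr (K-⊕ k a~y fy) (⊕-comm y x))
          (inj₂ (a~x , fx)) (inj₁ k) → inj₂ (~-shift a~x (proj₁ k) , K-⊕ k a~x fx)
          {x} {y} (inj₂ (a~x , fx)) (inj₂ (a~y , fy)) →
            let x~y = ~-trans (~-sym a~x) a~y in
            inj₁ (K-intro x~y λ c a~c fc fcu →
              ones-coset p x~y a~x fx (tr fy (sym (cancelˡ x y))) λ k → true≢ (K-⊕ k a~c fc) fcu)
        S⊆ : ∀ {a b} → ZeroPair a b → ∀ {x} → S a x → x ≢ 0v → f x ≡ true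
        S⊆ p (inj₁ k) x≢0 = K∖K⇒true p k (λ l → K∩K-trivial p k l x≢0)
        S⊆ p (inj₂ (_ , fx)) _ = fx
        disjoint : ∀ {x} → S a x → S b x → x ≡ 0v
        disjoint (inj₁ k) (inj₁ l) = decidable-stable (_ ≟ᵛ _) (K∩K-trivial p k l)
        disjoint (inj₁ k) (inj₂ (b~x , _)) = ⊥-elim (¬U-~ ¬Ub b~x (W⊆U (proj₁ k)))
        disjoint (inj₂ (a~x , _)) (inj₁ l) = ⊥-elim (¬U-~ ¬Ua a~x (W⊆U (proj₁ l)))
        disjoint (inj₂ (a~x , _)) (inj₂ (b~x , _)) = ⊥-elim (a≁b (~-trans a~x (~-sym b~x)))
        L : V n → Set
        L = Adjoin (a ⊕ b) W
        L⊆U : ∀ {x} → L x → U x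
        L⊆U (inj₁ h) = W⊆U h
        L⊆U (inj₂ h) = U.⊕∈⁻ (hyper ¬Ua ¬Ub) (W⊆U h)
        constant : ∀ {x} → U x → ¬ L x → ¬ ¬ Constant (a ⊕ x)
        constant {x} Ux ¬Lx ¬c = no-third p (¬U-⊕ ¬Ua Ux , ¬c)
          (λ h → ¬Lx (inj₁ (subst W (cancelˡ a x) h)))
          (λ h → ¬Lx (inj₂ (subst W (solve 3 (λ b a x → b :+ (a :+ x) ⊜ (a :+ b) :+ x) refl b a x) h)))
        via-a : ∀ {x} → U x → ¬ L x → f (a ⊕ x) ≡ f x
        via-a {x} Ux ¬Lx = stable λ ne → constant Ux ¬Lx λ c → ne
          (trans (constant-value Wz z≢0 fz Na (¬U-⊕ ¬Ua Ux) c) (cong f (cancelˡ a x)))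
        -- The coset of `a ⊕ x` is constant by `no-third`; its value is `f x` when read from `a` and
        -- `f (x ⊕ (a ⊕ b))` when read from `b`.
        via-b : ∀ {x} → U x → ¬ L x → f (x ⊕ (a ⊕ b)) ≡ f x
        via-b {x} Ux ¬Lx = stable λ ne → constant Ux ¬Lx λ c → ne
          (trans (cong f (solve 3 (λ x a b → x :+ (a :+ b) ⊜ b :+ (a :+ x)) refl x a b))
            (trans (sym (constant-value Wz z≢0 fz Nb (¬U-⊕ ¬Ua Ux) c)) (via-a Ux ¬Lx)))
        L-inv : ∀ {x l} → U x → ¬ L x → L l → f (x ⊕ l) ≡ f x
        L-inv Ux ¬Lx (inj₁ Wl) = inv Ux (¬Lx ∘ inj₁) Wl
        L-inv {x} {l} Ux ¬Lx (inj₂ h) = trans (cong f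
            (solve 4 (λ x l a b → x :+ l ⊜ (x :+ (a :+ b)) :+ ((a :+ b) :+ l)) refl x l a b))
          (trans (inv (U.⊕∈ Ux (hyper ¬Ua ¬Ub))
                   (λ h′ → ¬Lx (inj₂ (subst W (⊕-comm x (a ⊕ b)) h′))) h) (via-b Ux ¬Lx))
        all-L : ∀ {x} → U x → ¬ ¬ L x
        all-L Ux ¬Lx = decompose L (adjoin-subspace (a ⊕ b) W≤) L⊆U ¬Ua L-inv via-a Ux ¬Lx
        cover : ∀ {x} → f x ≡ true → ¬ ¬ (S a x ⊎ S b x)
        cover {x} fx none = by-cases (U x)
          (λ Ux → all-L Ux λ where
            (inj₁ Wx) → by-cases (K a x) (none ∘ inj₁ ∘ inj₁) λ ¬Ka → by-cases (K b x) (none ∘ inj₂ ∘ inj₁)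
              λ ¬Kb → true≢ fx (outside⇒false p Wx ¬Ka ¬Kb)
            (inj₂ h) → true≢ fx (trans (inv~ (hyper ¬Ua ¬Ub) a≁b h) fab))
          (λ ¬Ux → all-L (hyper ¬Ua ¬Ux) λ where
            (inj₁ h) → none (inj₁ (inj₂ (h , fx)))
            (inj₂ h) → none (inj₂ (inj₂ (subst W (cancel-both a b x) h , fx))))

  -- Differences of nonconstant cosets

  module _ {z : V n} (Wz : W z) (z≢0 : z ≢ 0v) (fz : f z ≡ false) {a : V n} (Na : N a) where

    private ¬Ua = proj₁ Na

    Y : V n → Set
    Y y = N (a ⊕ y)

    Y⊆U : ∀ y → Y y → U y
    Y⊆U y (¬Uay , _) = subst U (cancelˡ a y) (hyper ¬Ua ¬Uay)

    -- Off the span, `a ⊕ x` has a constant coset, whose value is `f x` read from `a` and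
    -- `f (x ⊕ y)` read from `a ⊕ y`. If the span were not all of `U`, `decompose` would apply to
    -- it.
    Y-spans : ∀ {x} → U x → ¬ ¬ Span Y x
    Y-spans = decompose (Span Y) (span-subspace Y) (span-⊆ U≤ Y⊆U) ¬Ua
      (λ {x} Ux ¬Lx Ll → proj₂ (proj₂ (translate {P = λ t → U t × ¬ Span Y t × f t ≡ f x}
        (λ { t y Yy (Ut , ¬Lt , e) → U.⊕∈ Ut (Y⊆U y Yy) ,
             (λ h → ¬Lt (Subspace.⊕∈⁻ʳ (span-subspace Y) (generator Yy) h)) , trans (step Ut ¬Lt Yy) e })
        Ll x (Ux , ¬Lx , refl))))
      via-a
      where
      via-a : ∀ {x} → U x → ¬ Span Y x → f (a ⊕ x) ≡ f x
      via-a {x} Ux ¬Lx = stable λ ne → by-cases (Constant (a ⊕ x))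
        (λ c → ne (trans (constant-value Wz z≢0 fz Na (¬U-⊕ ¬Ua Ux) c) (cong f (cancelˡ a x))))
        (λ ¬c → ¬Lx (generator (¬U-⊕ ¬Ua Ux , ¬c)))
      step : ∀ {x y} → U x → ¬ Span Y x → Y y → f (x ⊕ y) ≡ f x
      step {x} {y} Ux ¬Lx Yy = stable λ ne → by-cases (Constant (a ⊕ x))
        (λ c → ne (trans (cong f (solve 3 (λ x y a → x :+ y ⊜ (a :+ y) :+ (a :+ x)) refl x y a))
          (trans (sym (constant-value Wz z≢0 fz Yy (¬U-⊕ ¬Ua Ux) c)) (via-a Ux ¬Lx))))
        (λ ¬c → ¬Lx (generator (¬U-⊕ ¬Ua Ux , ¬c)))

    -- Every triangle meets `U`, and zeros in `U` lie in `W`. A triangle of zeros that leaves `U` is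
    -- thus a zero of `W` with a zero pair off `U`, but nonconstant cosets have no such pair and
    -- constant ones have value true. For a triangle inside `W`, the translates of its points by a
    -- zero of `a + W` are the ones of a claw.
    triangle-free : (∀ {x} → U x → ¬ W x → f x ≡ true) → (∀ {t} → N t → NoZeroPair t) →
      TriangleFreeComplement f
    triangle-free ones T x y x≢0 y≢0 x≢y fx fy fxy = by-cases (U x)
      (λ Ux → by-cases (U y)
        (λ Uy → zero⇒W Ux fx λ Wx → zero⇒W Uy fy λ Wy → inside Wx Wy)
        (λ ¬Uy → zero⇒W Ux fx λ Wx → zero-line ¬Uy Wx x≢0 fx fy (tr fxy (⊕-comm x y))))
      (λ ¬Ux → by-cases (U y)
        (λ Uy → zero⇒W Uy fy λ Wy → zero-line ¬Ux Wy y≢0 fy fx fxy)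
        (λ ¬Uy → zero⇒W (hyper ¬Ux ¬Uy) fxy λ Wxy →
          zero-line ¬Ux Wxy (⊕≢0 x≢y) fxy fx (tr fy (sym (cancelˡ x y)))))
      where
      zero⇒W : ∀ {x} → U x → f x ≡ false → ¬ ¬ W x
      zero⇒W Ux fx ¬Wx = true≢ (ones Ux ¬Wx) fx
      zero-line : ∀ {t u} → ¬ U t → W u → u ≢ 0v → f u ≡ false → f t ≡ false → f (t ⊕ u) ≡ false → ⊥
      zero-line {t} ¬Ut Wu u≢0 fu ft ftu = by-cases (Constant t)
        (λ c → true≢ (trans (constant-value Wz z≢0 fz Na ¬Ut c) (ones (hyper ¬Ua ¬Ut) (N≁constant Na c))) ft)
        (λ ¬c → T (¬Ut , ¬c) Wu u≢0 fu ~-refl ft ftu)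
      inside : W x → W y → ⊥
      inside Wx Wy = pick Na false λ b a~b fb →
        let one-at : ∀ {u} → W u → u ≢ 0v → f u ≡ false → f (b ⊕ u) ≡ true
            one-at Wu u≢0 fu = ≢false (T Na Wu u≢0 fu a~b fb)
            cancel : ∀ {u v} → b ⊕ u ≡ b ⊕ v → u ≡ v
            cancel {u} {v} e = trans (sym (cancelˡ b u)) (trans (cong (b ⊕_) e) (cancelˡ b v))
        in claw (b ⊕ x) (b ⊕ y) (b ⊕ (x ⊕ y)) (x≢y ∘ cancel) (shift≢ y≢0 ∘ cancel)
          (λ e → shift≢ x≢0 (trans (cancel e) (⊕-comm x y)))
          (one-at Wx x≢0 fx) (one-at Wy y≢0 fy) (one-at (W.⊕∈ Wx Wy) (⊕≢0 x≢y) fxy)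
          (tr fxy (sym (cancel-both b x y))) (tr fy
              (solve 3 (λ y b x → y ⊜ (b :+ x) :+ (b :+ (x :+ y))) refl y b x))
          (tr fx (solve 3 (λ x b y → x ⊜ (b :+ y) :+ (b :+ (x :+ y))) refl x b y))
          (tr fb (solve 3 (λ b x y → b ⊜ ((b :+ x) :+ (b :+ y)) :+ (b :+ (x :+ y))) refl b x y))

    without-zero-pairs : (∀ {b c} → ¬ ZeroPair b c) → TriangleFreeComplement f
    without-zero-pairs none = triangle-free ones T
      where
      one : ∀ {b c} → N b → N c → ¬ b ~ c → f (b ⊕ c) ≡ true
      one Nb Nc b≁c = ≢false λ e → none (zero-pair Nb Nc b≁c e)
      constant : ∀ {x} → U x → ¬ W x → f x ≡ false → ¬ ¬ Constant (a ⊕ x)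
      constant {x} Ux ¬Wx fx ¬c =
        true≢ (one Na (¬U-⊕ ¬Ua Ux , ¬c) (λ h → ¬Wx (subst W (cancelˡ a x) h)))
          (tr fx (sym (cancelˡ a x)))
      Zero : V n → Set
      Zero x = U x × ¬ W x × f x ≡ false
      -- A zero `x` off `W` makes the coset of `a ⊕ x` constant, since two nonconstant cosets always
      -- sum to a one. This keeps `x ⊕ y` off `W` and a zero.
      step : ∀ x y → Y y → Zero x → Zero (x ⊕ y)
      step x y Yy (Ux , ¬Wx , fx) = U.⊕∈ Ux (Y⊆U y Yy) ,
        (λ h → constant Ux ¬Wx fx λ c →
          N≁constant Yy c (subst W (solve 3 (λ x y a → x :+ y ⊜ (a :+ y) :+ (a :+ x)) refl x y a) h)) ,
        stable λ ne → constant Ux ¬Wx fx λ c → ne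
            (trans (cong f (solve 3 (λ x y a → x :+ y ⊜ (a :+ y) :+ (a :+ x)) refl x y a))
          (trans (sym (constant-value Wz z≢0 fz Yy (¬U-⊕ ¬Ua Ux) c))
            (trans (constant-value Wz z≢0 fz Na (¬U-⊕ ¬Ua Ux) c) (tr fx (sym (cancelˡ a x))))))
      ones : ∀ {x} → U x → ¬ W x → f x ≡ true
      ones {x} Ux ¬Wx = ≢false λ fx → Y-spans Ux λ Lx →
        proj₁ (proj₂ (translate step Lx x (Ux , ¬Wx , fx))) ~-refl
      -- If `a + W` were the only nonconstant coset, all differences would lie in `W` and could not
      -- span `x₀`.
      partner : (∀ b → N b → ¬ a ~ b → ⊥) → ⊥
      partner h = Y-spans Ux₀ λ s → span-⊆ (¬¬-subspace W≤)
        (λ y Yy ¬Wy → h (a ⊕ y) Yy (λ w → ¬Wy (subst W (cancelˡ a y) w))) s ¬Wx₀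
      T : ∀ {t} → N t → NoZeroPair t
      T {t} Nt Wu u≢0 fu t~c fc fcu = by-cases (a ~ t)
        (λ a~t → partner λ b Nb a≁b → let t≁b = λ t~b → a≁b (~-trans a~t t~b) in
          no-zero-pair Nt Nb t≁b (one Nt Nb t≁b) Wu u≢0 fu t~c fc fcu)
        (λ a≁t → let t≁a = λ t~a → a≁t (~-sym t~a) in
          no-zero-pair Nt Na t≁a (one Nt Na t≁a) Wu u≢0 fu t~c fc fcu)

  -- Three cosets off `U` and the coset of their sum

  Takes : V n → Bool → Set
  Takes a v = ∃ λ b → a ~ b × f b ≡ v

  takes-own : ∀ {a v} → f a ≡ v → Takes a v
  takes-own fa = _ , ~-refl , fa

  record Quad (a b c : V n) : Set where
    constructor quad
    field
      ¬Ua : ¬ U a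
      ¬Ub : ¬ U b
      ¬Uc : ¬ U c
      a≁b : ¬ a ~ b
      a≁c : ¬ a ~ c
      b≁c : ¬ b ~ c

  quad-shift : ∀ {a b c a′ b′ c′} → Quad a b c → a ~ a′ → b ~ b′ → c ~ c′ → Quad a′ b′ c′
  quad-shift (quad ¬Ua ¬Ub ¬Uc a≁b a≁c b≁c) p q r =
    quad (¬U-~ ¬Ua p) (¬U-~ ¬Ub q) (¬U-~ ¬Uc r)
      (λ h → a≁b (~-trans p (~-trans h (~-sym q))))
      (λ h → a≁c (~-trans p (~-trans h (~-sym r))))
      (λ h → b≁c (~-trans q (~-trans h (~-sym r))))

  quad-reverse : ∀ {a b c} → Quad a b c → Quad c b a
  quad-reverse (quad ¬Ua ¬Ub ¬Uc a≁b a≁c b≁c) =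
    quad ¬Uc ¬Ub ¬Ua (b≁c ∘ ~-sym) (a≁c ∘ ~-sym) (a≁b ∘ ~-sym)

  quad-rotate : ∀ {a b c} → Quad a b c → Quad b c a
  quad-rotate (quad ¬Ua ¬Ub ¬Uc a≁b a≁c b≁c) =
    quad ¬Ub ¬Uc ¬Ua b≁c (a≁b ∘ ~-sym) (a≁c ∘ ~-sym)

  quad-fourth : ∀ {a b c} → Quad a b c → Quad a b ((a ⊕ b) ⊕ c)
  quad-fourth {a} {b} {c} (quad ¬Ua ¬Ub ¬Uc a≁b a≁c b≁c) =
    quad ¬Ua ¬Ub (λ h → ¬Uc (U.⊕∈⁻ (hyper ¬Ua ¬Ub) h)) a≁b
      (λ h → b≁c (subst W (solve 3 (λ a b c → a :+ ((a :+ b) :+ c) ⊜ b :+ c) refl a b c) h))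
      (λ h → a≁c (subst W (solve 3 (λ b a c → b :+ ((a :+ b) :+ c) ⊜ a :+ c) refl b a c) h))

  -- The digits in this and the next two names are the values at `a`, `b`, `c`; the fourth point is
  -- always a zero.
  claw-111 : ∀ {a b c} → Quad a b c → f (a ⊕ b) ≡ false → f (a ⊕ c) ≡ false → f (b ⊕ c) ≡ false →
    f a ≡ true → f b ≡ true → f c ≡ true → f ((a ⊕ b) ⊕ c) ≡ false → ⊥
  claw-111 (quad _ _ _ a≁b a≁c b≁c) ab ac bc fa fb fc fd =
    claw _ _ _ (≁⇒≢ a≁b) (≁⇒≢ a≁c) (≁⇒≢ b≁c) fa fb fc ab ac bc fd

  claw-100 : ∀ {a b c} → Quad a b c → f (a ⊕ b) ≡ true → f (a ⊕ c) ≡ true → f (b ⊕ c) ≡ false →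
    f a ≡ true → f b ≡ false → f c ≡ false → f ((a ⊕ b) ⊕ c) ≡ false → ⊥
  claw-100 {a} {b} {c} (quad _ ¬Ub ¬Uc a≁b a≁c b≁c) ab ac bc fa fb fc fd =
    claw a (a ⊕ b) (a ⊕ c) (shift≢ (λ { refl → ¬Ub U.0∈ })) (shift≢ (λ { refl → ¬Uc U.0∈ }))
      (λ e → ≁⇒≢ b≁c (trans (sym (cancelˡ a b)) (trans (cong (a ⊕_) e) (cancelˡ a c))))
      fa ab ac (tr fb (sym (cancelˡ a b))) (tr fc (sym (cancelˡ a c)))
      (tr bc (sym (cancel-both a b c))) (tr fd (sym (cancel-both a (a ⊕ b) c)))

  claw-110 : ∀ {a b c} → Quad a b c → f (a ⊕ b) ≡ false → f (a ⊕ c) ≡ true → f (b ⊕ c) ≡ false →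
    f a ≡ true → f b ≡ true → f c ≡ false → f ((a ⊕ b) ⊕ c) ≡ false → ⊥
  claw-110 {a} {b} {c} (quad ¬Ua ¬Ub ¬Uc a≁b a≁c b≁c) ab ac bc fa fb fc fd =
    claw (a ⊕ c) a b (λ e → ¬Ua (subst U e Uac)) (λ e → ¬Ub (subst U e Uac)) (≁⇒≢ a≁b)
      ac fa fb (tr fc (solve 2 (λ c a → c ⊜ (a :+ c) :+ a) refl c a))
          (tr fd (solve 3 (λ a b c → (a :+ b) :+ c ⊜ (a :+ c) :+ b) refl a b c)) ab
      (tr bc (solve 3 (λ b c a → b :+ c ⊜ ((a :+ c) :+ a) :+ b) refl b c a))
    where Uac = hyper ¬Ua ¬Uc

  -- As the fourth coset is constant, the values on the other three can be prescribed independently.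
  realize : ∀ {a b c va vb vc} → Quad a b c → Constant ((a ⊕ b) ⊕ c) →
    Takes a va → Takes b vb → Takes c vc →
    (∀ {a′ b′ c′} → Quad a′ b′ c′ → f a′ ≡ va → f b′ ≡ vb → f c′ ≡ vc →
      f ((a′ ⊕ b′) ⊕ c′) ≡ f ((a ⊕ b) ⊕ c) →
      f (a′ ⊕ b′) ≡ f (a ⊕ b) → f (a′ ⊕ c′) ≡ f (a ⊕ c) → f (b′ ⊕ c′) ≡ f (b ⊕ c) → ⊥) → ⊥
  realize {a} {b} {c} q@(quad ¬Ua ¬Ub ¬Uc a≁b a≁c b≁c) cd (a′ , p₁ , e₁) (b′ , p₂ , e₂) (c′ , p₃ , e₃) k =
    k (quad-shift q p₁ p₂ p₃) e₁ e₂ e₃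
      (cd _ (subst W (solve 6 (λ a a′ b b′ c c′ → ((a :+ a′) :+ (b :+ b′)) :+ (c :+ c′) ⊜ ((a :+ b) :+ c) :+
          ((a′ :+ b′) :+ c′)) refl a a′ b b′ c c′)
        (W.⊕∈ (W.⊕∈ p₁ p₂) p₃)))
      (line ¬Ua ¬Ub a≁b p₁ p₂) (line ¬Ua ¬Uc a≁c p₁ p₃) (line ¬Ub ¬Uc b≁c p₂ p₃)

  -- The case where `W` consists of `0v` and `u`

  module TwoPoint {u : V n} (Wu : W u) (u≢0 : u ≢ 0v) (W≡ : ∀ {w} → W w → w ≡ 0v ⊎ w ≡ u) where

    constant-intro : ∀ {a} → f (a ⊕ u) ≡ f a → Constant a
    constant-intro {a} e b a~b = case W≡ a~b of λ where
      (inj₁ h) → cong f (trans (sym (cancelˡ a b)) (trans (cong (a ⊕_) h) (⊕-identityʳ a)))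
      (inj₂ h) → trans (cong f (trans (sym (cancelˡ a b)) (cong (a ⊕_) h))) e

    flip : ∀ {a} → N a → f (a ⊕ u) ≡ not (f a)
    flip (_ , ¬ca) = ¬-not (¬ca ∘ constant-intro)

    N? : ∀ {a} → ¬ U a → Constant a ⊎ N a
    N? {a} ¬Ua = case f (a ⊕ u) ≟ᵇ f a of λ where
      (yes e) → inj₁ (constant-intro e)
      (no ne) → inj₂ (¬Ua , λ c → ne (c (a ⊕ u) (~-shift ~-refl Wu)))

    takes : ∀ {a} → N a → ∀ v → Takes a v
    takes {a} Na v = case f a ≟ᵇ v of λ where
      (yes e) → takes-own e
      (no ne) → a ⊕ u , ~-shift ~-refl Wu , trans (flip Na) (sym (¬-not (λ e → ne (sym e))))

    W? : ∀ y → W y ⊎ ¬ W y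
    W? y = case y ≟ᵛ 0v of λ where
      (yes refl) → inj₁ W.0∈
      (no p) → case y ≟ᵛ u of λ where
        (yes refl) → inj₁ Wu
        (no q) → inj₂ λ h → case W≡ h of λ where
          (inj₁ e) → p e
          (inj₂ e) → q e

    -- The subcase where `f u` is true

    module Ones (fu : f u ≡ true) {a : V n} (Na : N a) where

      private ¬Ua = proj₁ Na

      mixed-line : ∀ {b c} → N b → N c → ¬ b ~ c → f (b ⊕ c) ≡ true
      mixed-line {b} {c} Nb@(¬Ub , _) Nc@(¬Uc , _) b≁c = ≢false λ e →
        pick Nb true λ b′ p fb′ → pick Nc true λ c′ q fc′ →
          claw-two (¬U-~ ¬Ub p) (¬U-~ ¬Uc q) (λ h → b≁c (~-trans p (~-trans h (~-sym q)))) Wu fu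
            (trans (line ¬Ub ¬Uc b≁c p q) e)
            fc′ (trans (flip (N-~ q Nc)) (cong not fc′)) fb′ (trans (flip (N-~ p Nb)) (cong not fb′))

      -- Off `W`, the set `Y₁` holds those `y` for which the coset of `a ⊕ y` takes the value other
      -- than `f y`; hence off its span `f (a ⊕ x)` equals `f x`, as `decompose` demands. `C` is the
      -- property that is carried along `Y₁`.
      Zero C Y₁ : V n → Set
      Zero x = U x × ¬ W x × f x ≡ false
      C x = Zero x × f (a ⊕ x) ≡ false
      Y₁ y = U y × (W y ⊎ f y ≡ false × f (a ⊕ y) ≡ true ⊎ f y ≡ true × Takes (a ⊕ y) false)

      a≁a⊕ : ∀ {x} → ¬ W x → ¬ a ~ a ⊕ x
      a≁a⊕ {x} ¬Wx h = ¬Wx (subst W (cancelˡ a x) h)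

      zero-constant : ∀ {x} → Zero x → Constant (a ⊕ x)
      zero-constant {x} (Ux , ¬Wx , fx) = case N? (¬U-⊕ ¬Ua Ux) of λ where
        (inj₁ c) → c
        (inj₂ Nax) → ⊥-elim (true≢ (mixed-line Na Nax (a≁a⊕ ¬Wx)) (tr fx (sym (cancelˡ a x))))

      module _ {x y : V n} (Cx : C x) (Uy : U y) (¬Wy : ¬ W y) (¬Wxy : ¬ W (x ⊕ y)) where

        private
          Ux = proj₁ (proj₁ Cx)
          ¬Wx = proj₁ (proj₂ (proj₁ Cx))
          r = a ⊕ (x ⊕ y)
          s≡ : a ⊕ x ≡ (a ⊕ (a ⊕ y)) ⊕ r
          s≡ = (solve 3 (λ a x y → a :+ x ⊜ (a :+ (a :+ y)) :+ (a :+ (x :+ y))) refl a x y)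

        Q : Quad a (a ⊕ y) r
        Q = quad ¬Ua (¬U-⊕ ¬Ua Uy) (¬U-⊕ ¬Ua (U.⊕∈ Ux Uy)) (a≁a⊕ ¬Wy) (a≁a⊕ ¬Wxy)
          (λ h → ¬Wx (subst W (solve 3 (λ a y x → (a :+ y) :+ (a :+ (x :+ y)) ⊜ x) refl a y x) h))

        -- The fourth coset of `Q` is that of `a ⊕ x`, constantly false, so the value `w` at the
        -- first point is free; the steps below choose it so as to produce a claw.
        realize-Q : ∀ {v v′ t t′} → Takes (a ⊕ y) v′ → f r ≡ t → f y ≡ v → f (x ⊕ y) ≡ t′ → ∀ w →
          (∀ {p q r} → Quad p q r → f p ≡ w → f q ≡ v′ → f r ≡ t → f ((p ⊕ q) ⊕ r) ≡ false →
            f (p ⊕ q) ≡ v → f (p ⊕ r) ≡ t′ → f (q ⊕ r) ≡ false → ⊥) → ⊥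
        realize-Q tq fr fy fxy w k = realize Q (subst Constant s≡ (zero-constant (proj₁ Cx)))
          (takes Na w) tq (takes-own fr) λ q fp′ fq′ fr′ fs′ pq pr qr →
            k q fp′ fq′ fr′ (trans fs′ (tr (proj₂ Cx) s≡))
              (trans pq (tr fy (sym (cancelˡ a y)))) (trans pr (tr fxy (sym (cancelˡ a (x ⊕ y)))))
              (trans qr (tr (proj₂ (proj₂ (proj₁ Cx)))
                  (solve 3 (λ x a y → x ⊜ (a :+ y) :+ (a :+ (x :+ y))) refl x a y)))

        -- In both steps a + W takes both values and a + x + W is constantly 0.
        step₀ : f y ≡ false → Takes (a ⊕ y) true → f (x ⊕ y) ≡ false × f r ≡ false
        step₀ fy tq = fxy , ≢true λ fr → realize-Q tq fr fy fxy true
            λ q fp fq fr fs pq pr qr → claw-111 q pq pr qr fp fq fr fs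
          where
          fxy : f (x ⊕ y) ≡ false
          fxy = ≢true λ t → case split (f r) of λ where
            (inj₁ fr) → realize-Q tq fr fy t false λ {p} {q} {r} Q fp fq fr fs pq pr qr →
              claw-110 (quad-reverse Q) (tr qr (⊕-comm q r)) (tr pr (⊕-comm p r)) (tr pq (⊕-comm p q))
                fr fq fp (tr fs (solve 3 (λ p q r → (p :+ q) :+ r ⊜ (r :+ q) :+ p) refl p q r))
            (inj₂ fr) → realize-Q tq fr fy t true λ Q fp fq fr fs pq pr qr →
              claw-110 Q pq pr qr fp fq fr fs

        step₁ : f y ≡ true → Takes (a ⊕ y) false → f (x ⊕ y) ≡ false × f r ≡ false
        step₁ fy tq = fxy , ≢true λ fr → realize-Q tq fr fy fxy true
            λ {p} {q} {r} Q fp fq fr fs pq pr qr →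
              claw-110 (quad-reverse (quad-rotate Q)) pr pq (tr qr (⊕-comm q r))
                fp fr fq (tr fs (solve 3 (λ p q r → (p :+ q) :+ r ⊜ (p :+ r) :+ q) refl p q r))
          where
          fxy : f (x ⊕ y) ≡ false
          fxy = ≢true λ t → case split (f r) of λ where
            (inj₁ fr) → realize-Q tq fr fy t false λ {p} {q} {r} Q fp fq fr fs pq pr qr →
              claw-100 (quad-fourth (quad-rotate (quad-rotate Q))) (tr pr (⊕-comm p r))
                (tr pq (solve 3 (λ p q r → p :+ q ⊜ r :+ ((r :+ p) :+ q)) refl p q r))
                    (tr qr (solve 3 (λ q r p → q :+ r ⊜ p :+ ((r :+ p) :+ q)) refl q r p))
                fr fp (tr fs (solve 3 (λ p q r → (p :+ q) :+ r ⊜ (r :+ p) :+ q) refl p q r))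
                    (tr fq (sym (cancelˡ (r ⊕ p) q)))
            (inj₂ fr) → realize-Q tq fr fy t true λ Q fp fq fr fs pq pr qr →
              claw-100 Q pq pr qr fp fq fr fs

      step-W : ∀ {x y} → W y → C x → C (x ⊕ y)
      step-W {x} {y} Wy ((Ux , ¬Wx , fx) , fax) =
        (U.⊕∈ Ux (W⊆U Wy) , (λ h → ¬Wx (W.⊕∈⁻ʳ Wy h)) , trans (inv Ux ¬Wx Wy) fx) ,
        tr (constant-⊕ (zero-constant (Ux , ¬Wx , fx)) Wy fax) (⊕-assoc a x y)

      step : ∀ x y → Y₁ y → C x → C (x ⊕ y)
      step x y (Uy , h) Cx@(Zx@(Ux , ¬Wx , fx) , fax) = case W? y of λ where
        (inj₁ Wy) → step-W Wy Cx
        (inj₂ ¬Wy) → case h of λ where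
          (inj₁ Wy) → step-W Wy Cx
          (inj₂ (inj₁ (fy , fay))) →
            let ¬Wxy = λ h → true≢ fay (trans (zero-constant Zx _ (subst W (sym (cancel-both a x y)) h)) fax)
                (fxy , fr) = step₀ Cx Uy ¬Wy ¬Wxy fy (takes-own fay)
            in (U.⊕∈ Ux Uy , ¬Wxy , fxy) , fr
          (inj₂ (inj₂ (fy , tay))) →
            let ¬Wxy = λ h → true≢ fy (trans (inv~ Ux ¬Wx h) fx)
                (fxy , fr) = step₁ Cx Uy ¬Wy ¬Wxy fy tay
            in (U.⊕∈ Ux Uy , ¬Wxy , fxy) , fr

      Y₁-spans : ∀ {x} → U x → ¬ ¬ Span Y₁ x
      Y₁-spans = decompose L L≤ (span-⊆ U≤ (λ _ → proj₁)) ¬Ua L-inv via-a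
        where
        L = Span Y₁
        L≤ = span-subspace Y₁
        W⊆L : ∀ {x} → W x → L x
        W⊆L Wx = generator (W⊆U Wx , inj₁ Wx)
        via-a : ∀ {x} → U x → ¬ L x → f (a ⊕ x) ≡ f x
        via-a {x} Ux ¬Lx = stable λ ne → case split (f x) of λ where
          (inj₁ t) → ¬Lx (generator (Ux , inj₂ (inj₂ (t , takes-own (≢true (λ t′ → ne (trans t′ (sym t))))))))
          (inj₂ e) → ¬Lx (generator (Ux , inj₂ (inj₁ (e , ≢false (λ e′ → ne (trans e′ (sym e)))))))
        zero-inv : ∀ {x l} → U x → ¬ L x → L l → f x ≡ false → f (x ⊕ l) ≡ false
        zero-inv {x} Ux ¬Lx Ll fx = proj₂ (proj₂ (proj₁
          (translate step Ll x ((Ux , ¬Lx ∘ W⊆L , fx) , trans (via-a Ux ¬Lx) fx))))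
        L-inv : ∀ {x l} → U x → ¬ L x → L l → f (x ⊕ l) ≡ f x
        L-inv {x} {l} Ux ¬Lx Ll = stable λ ne → case split (f x) of λ where
          (inj₂ e) → ne (trans (zero-inv Ux ¬Lx Ll e) (sym e))
          (inj₁ t) → true≢ t (tr (zero-inv (U.⊕∈ Ux (span-⊆ U≤ (λ _ → proj₁) Ll))
            (λ h → ¬Lx (Subspace.⊕∈⁻ʳ L≤ Ll h)) Ll (≢true (λ t′ → ne (trans t′ (sym t)))))
            (cancelʳ x l))

      -- Otherwise `x` is in `C`, and walking along `x` itself ends at `x ⊕ x`, which is in `W` and
      -- so not in `C`.
      opposite : ∀ {x} → Zero x → f (a ⊕ x) ≡ true
      opposite {x} Zx@(Ux , _) = ≢false λ e → Y₁-spans Ux λ Lx →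
        proj₁ (proj₂ (proj₁ (translate step Lx x (Zx , e)))) ~-refl

      opposite′ : ∀ {t} → ¬ U t → ¬ a ~ t → f t ≡ false → f (a ⊕ t) ≡ true
      opposite′ {t} ¬Ut a≁t ft = ≢false λ e →
        true≢ (opposite (hyper ¬Ua ¬Ut , a≁t , e)) (tr ft (sym (cancelˡ a t)))

      triangle-free-ones : TriangleFreeComplement f
      triangle-free-ones x y x≢0 y≢0 x≢y fx fy fxy = by-cases (U x)
          (λ Ux → by-cases (U y)
            (λ Uy → inside (Ux , zero-∉W x≢0 fx , fx) (Uy , zero-∉W y≢0 fy , fy)
              (U.⊕∈ Ux Uy , zero-∉W (⊕≢0 x≢y) fxy , fxy))
            (λ ¬Uy → outside (Ux , zero-∉W x≢0 fx , fx) ¬Uy fy (tr fxy (⊕-comm x y))))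
          (λ ¬Ux → by-cases (U y)
            (λ Uy → outside (Uy , zero-∉W y≢0 fy , fy) ¬Ux fx fxy)
            (λ ¬Uy → outside (hyper ¬Ux ¬Uy , zero-∉W (⊕≢0 x≢y) fxy , fxy) ¬Ux fx
              (tr fy (sym (cancelˡ x y)))))
        where
        zero-∉W : ∀ {x} → x ≢ 0v → f x ≡ false → ¬ W x
        zero-∉W x≢0 fx Wx = case W≡ Wx of λ where
          (inj₁ e) → x≢0 e
          (inj₂ refl) → true≢ fu fx
        inside : ∀ {x y} → Zero x → Zero y → Zero (x ⊕ y) → ⊥
        inside {x} {y} Zx@(Ux , ¬Wx , fx) Zy@(Uy , ¬Wy , fy) Zxy@(_ , ¬Wxy , fxy) =
          -- The other three points of the quad are ones by `opposite`; choosing false at `a` makes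
          -- them a claw.
          realize (quad ¬Ua (¬U-⊕ ¬Ua Ux) (¬U-⊕ ¬Ua Uy) (a≁a⊕ ¬Wx) (a≁a⊕ ¬Wy)
              (λ h → ¬Wxy (subst W (cancel-both a x y) h)))
            (subst Constant s≡ (zero-constant Zxy)) (takes Na false)
            (takes-own (opposite Zx)) (takes-own (opposite Zy))
            λ {p} {q} {r} Q fp fq fr fs pq pr qr →
              claw-111 (quad-fourth (quad-rotate Q)) (trans qr (tr fxy (sym (cancel-both a x y))))
                (tr (trans pr (tr fy (sym (cancelˡ a y))))
                    (solve 3 (λ p r q → p :+ r ⊜ q :+ ((q :+ r) :+ p)) refl p r q))
                (tr (trans pq (tr fx (sym (cancelˡ a x))))
                    (solve 3 (λ p q r → p :+ q ⊜ r :+ ((q :+ r) :+ p)) refl p q r))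
                fq fr (tr (trans fs (tr (opposite Zxy) s≡))
                    (solve 3 (λ p q r → (p :+ q) :+ r ⊜ (q :+ r) :+ p) refl p q r))
                (tr fp (sym (cancelˡ (q ⊕ r) p)))
          where s≡ = (solve 3 (λ a x y → a :+ (x :+ y) ⊜ (a :+ (a :+ x)) :+ (a :+ y)) refl a x y)
        outside : ∀ {x t} → Zero x → ¬ U t → f t ≡ false → f (t ⊕ x) ≡ false → ⊥
        outside {x} {t} Zx@(Ux , ¬Wx , fx) ¬Ut ft ftx = by-cases (a ~ t)
          (λ a~t → true≢ (opposite Zx) (trans (sym (zero-constant Zx (t ⊕ x)
            (subst W (solve 3 (λ a t x → a :+ t ⊜ (a :+ x) :+ (t :+ x)) refl a t x) a~t))) ftx))
          λ a≁t → by-cases (a ~ t ⊕ x)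
            (λ a~tx → true≢ (opposite Zx) (trans (sym (zero-constant Zx t
              (subst W (solve 3 (λ a t x → a :+ (t :+ x) ⊜ (a :+ x) :+ t) refl a t x) a~tx))) ft))
            -- Choosing false at `a` leaves the fourth point, in the coset of `a ⊕ x`, as the only
            -- one of the quad.
            λ a≁tx → realize (quad ¬Ua ¬Ut (¬U-⊕ ¬Ut Ux) a≁t a≁tx
                (λ h → ¬Wx (subst W (cancelˡ t x) h)))
              (subst Constant s≡ (zero-constant Zx)) (takes Na false) (takes-own ft) (takes-own ftx)
              λ {p} {q} {r} Q fp fq fr fs pq pr qr →
                claw-100 (quad-rotate (quad-rotate (quad-fourth (quad-rotate Q))))
                  (tr (trans pr (opposite′ (¬U-⊕ ¬Ut Ux) a≁tx ftx))
                      (solve 3 (λ p r q → p :+ r ⊜ ((q :+ r) :+ p) :+ q) refl p r q))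
                  (tr (trans pq (opposite′ ¬Ut a≁t ft))
                      (solve 3 (λ p q r → p :+ q ⊜ ((q :+ r) :+ p) :+ r) refl p q r))
                  (trans qr (tr fx (sym (cancelˡ t x))))
                  (tr (trans fs (tr (opposite Zx) s≡))
                      (solve 3 (λ p q r → (p :+ q) :+ r ⊜ (q :+ r) :+ p) refl p q r))
                  fq fr (tr fp (solve 3 (λ p q r → p ⊜ (((q :+ r) :+ p) :+ q) :+ r) refl p q r))
          where s≡ = (solve 3 (λ a x t → a :+ x ⊜ (a :+ t) :+ (t :+ x)) refl a x t)

    -- The subcase where `f u` is false

    module Zeros (fu : f u ≡ false) {a : V n} (Na : N a) where

      private
        ¬Ua = proj₁ Na
        value : ∀ {a b} → N a → ¬ U b → Constant b → f b ≡ f (a ⊕ b)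
        value = constant-value Wu u≢0 fu

      f-⊕u : ∀ {x} → U x → f (x ⊕ u) ≡ f x
      f-⊕u {x} Ux = case W? x of λ where
        (inj₂ ¬Wx) → inv Ux ¬Wx Wu
        (inj₁ Wx) → case W≡ Wx of λ where
          (inj₁ refl) → trans (tr fu (sym (⊕-identityˡ u))) (sym f0)
          (inj₂ refl) → trans (tr f0 (sym (⊕-self u))) (sym fu)

      parity : V n → V n → V n → Bool
      parity a b c = (f a xor f ((a ⊕ b) ⊕ c)) xor (f b xor f c)

      parity-value : ∀ {a b c va vb vc} → f a ≡ va → f b ≡ vb → f c ≡ vc → f ((a ⊕ b) ⊕ c) ≡ true →
        parity a b c ≡ (va xor true) xor (vb xor vc)
      parity-value fa fb fc fd = cong₂ _xor_ (cong₂ _xor_ fa fd) (cong₂ _xor_ fb fc)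

      ~-cases : ∀ {a b} → a ~ b → b ≡ a ⊎ b ≡ a ⊕ u
      ~-cases {a} {b} a~b = case W≡ a~b of λ where
        (inj₁ e) → inj₁ (trans (sym (cancelˡ a b)) (trans (cong (a ⊕_) e) (⊕-identityʳ a)))
        (inj₂ e) → inj₂ (trans (sym (cancelˡ a b)) (cong (a ⊕_) e))

      parity-shift₁ : ∀ {a b c a′} → N a → N ((a ⊕ b) ⊕ c) → a ~ a′ → parity a′ b c ≡ parity a b c
      parity-shift₁ {a} {b} {c} Na Nd a~a′ = case ~-cases a~a′ of λ where
        (inj₁ refl) → refl
        (inj₂ refl) → cong (_xor (f b xor f c)) (trans
          (cong₂ _xor_ (flip Na) (trans (cong f
              (solve 4 (λ a u b c → ((a :+ u) :+ b) :+ c ⊜ ((a :+ b) :+ c) :+ u) refl a u b c)) (flip Nd)))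
          (xor-annihilates-not (f a) _))

      parity-swap : ∀ a b c → parity a b c ≡ parity b a c
      parity-swap a b c rewrite ⊕-comm a b =
        ⊻.solve 4 (λ p q r s → (p ⊻.:+ s) ⊻.:+ (q ⊻.:+ r) ⊻.:= (q ⊻.:+ s) ⊻.:+ (p ⊻.:+ r)) refl
          (f a) (f b) (f c) (f ((b ⊕ a) ⊕ c))

      parity-rotate : ∀ a b c → parity a b c ≡ parity c a b
      parity-rotate a b c rewrite (solve 3 (λ c a b → (c :+ a) :+ b ⊜ (a :+ b) :+ c) refl c a b) =
        ⊻.solve 4 (λ p q r s → (p ⊻.:+ s) ⊻.:+ (q ⊻.:+ r) ⊻.:= (r ⊻.:+ s) ⊻.:+ (p ⊻.:+ q)) refl
          (f a) (f b) (f c) (f ((a ⊕ b) ⊕ c))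

      -- Adding `u` to one of the three points flips its own value and that of the fourth point,
      -- since both cosets are nonconstant.
      parity-shift : ∀ {a b c a′ b′ c′} → N a → N b → N c → N ((a ⊕ b) ⊕ c) →
        a ~ a′ → b ~ b′ → c ~ c′ → parity a′ b′ c′ ≡ parity a b c
      parity-shift {a} {b} {c} {a′} {b′} {c′} Na Nb Nc Nd a~ b~ c~ = begin
        parity a′ b′ c′ ≡⟨ parity-rotate a′ b′ c′ ⟩
        parity c′ a′ b′ ≡⟨ parity-shift₁ Nc (subst N
            (solve 3 (λ a′ b′ c → (a′ :+ b′) :+ c ⊜ (c :+ a′) :+ b′) refl a′ b′ c) N₂) c~ ⟩
        parity c a′ b′ ≡⟨ parity-rotate a′ b′ c ⟨
        parity a′ b′ c ≡⟨ parity-swap a′ b′ c ⟩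
        parity b′ a′ c ≡⟨ parity-shift₁ Nb (subst N
            (solve 3 (λ a′ b c → (a′ :+ b) :+ c ⊜ (b :+ a′) :+ c) refl a′ b c) N₁) b~ ⟩
        parity b a′ c ≡⟨ parity-swap a′ b c ⟨
        parity a′ b c ≡⟨ parity-shift₁ Na Nd a~ ⟩
        parity a b c ∎
        where
        open ≡-Reasoning
        N₁ : N ((a′ ⊕ b) ⊕ c)
        N₁ = N-~ (subst W (solve 4 (λ a a′ b c → a :+ a′ ⊜ ((a :+ b) :+ c) :+ ((a′ :+ b) :+ c)) refl a a′ b c)
            a~) Nd
        N₂ : N ((a′ ⊕ b′) ⊕ c)
        N₂ = N-~ (subst W (solve 4 (λ b b′ a′ c → b :+ b′ ⊜ ((a′ :+ b) :+ c) :+ ((a′ :+ b′) :+ c)) refl b b′ a′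
            c) b~) N₁

      realize-N : ∀ {a b c} → Quad a b c → N a → N b → N c → N ((a ⊕ b) ⊕ c) → ∀ va vb vc →
        (∀ {a′ b′ c′} → Quad a′ b′ c′ → f a′ ≡ va → f b′ ≡ vb → f c′ ≡ vc →
          f (a′ ⊕ b′) ≡ f (a ⊕ b) → f (a′ ⊕ c′) ≡ f (a ⊕ c) → f (b′ ⊕ c′) ≡ f (b ⊕ c) →
          f ((a′ ⊕ b′) ⊕ c′) ≡ true) →
        parity a b c ≡ (va xor true) xor (vb xor vc)
      realize-N q@(quad ¬Ua ¬Ub ¬Uc a≁b a≁c b≁c) Na Nb Nc Nd va vb vc k =
        let (a′ , p₁ , e₁) = takes Na va
            (b′ , p₂ , e₂) = takes Nb vb
            (c′ , p₃ , e₃) = takes Nc vc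
        in trans (sym (parity-shift Na Nb Nc Nd p₁ p₂ p₃))
          (parity-value e₁ e₂ e₃ (k (quad-shift q p₁ p₂ p₃) e₁ e₂ e₃
            (line ¬Ua ¬Ub a≁b p₁ p₂) (line ¬Ua ¬Uc a≁c p₁ p₃) (line ¬Ub ¬Uc b≁c p₂ p₃)))

      -- For each pair of values on the other two lines, the values at `a`, `b`, `c` are prescribed
      -- so that a zero at the fourth point would give a claw. The fourth value is then true, and
      -- the parity can be computed from this one choice.
      parity-line : ∀ {a b c} → Quad a b c → N a → N b → N c → N ((a ⊕ b) ⊕ c) → f (a ⊕ b) ≡ false →
        parity a b c ≡ f (a ⊕ c) xor f (b ⊕ c)
      parity-line {a} {b} {c} q Na Nb Nc Nd fab = case split (f (a ⊕ c)) of λ where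
        (inj₁ ac) → case split (f (b ⊕ c)) of λ where
          (inj₁ bc) → trans (realize-N q Na Nb Nc Nd false false true
              λ {a} {b} {c} q fa fb fc ab′ ac′ bc′ → ≢false λ fd →
                claw-100 (quad-rotate (quad-rotate q)) (tr (trans ac′ ac) (⊕-comm a c))
                  (tr (trans bc′ bc) (⊕-comm b c)) (trans ab′ fab) fc fa fb
                  (tr fd (solve 3 (λ a b c → (a :+ b) :+ c ⊜ (c :+ a) :+ b) refl a b c)))
            (sym (cong₂ _xor_ ac bc))
          (inj₂ bc) → trans (realize-N q Na Nb Nc Nd true true false
              λ q fa fb fc ab′ ac′ bc′ → ≢false λ fd →
                claw-110 q (trans ab′ fab) (trans ac′ ac) (trans bc′ bc) fa fb fc fd)
            (sym (cong₂ _xor_ ac bc))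
        (inj₂ ac) → case split (f (b ⊕ c)) of λ where
          (inj₁ bc) → trans (realize-N q Na Nb Nc Nd true true false
              λ {a} {b} {c} q fa fb fc ab′ ac′ bc′ → ≢false λ fd →
                claw-110 (quad-rotate (quad-reverse q)) (tr (trans ab′ fab) (⊕-comm a b))
                  (trans bc′ bc) (trans ac′ ac) fb fa fc (tr fd (cong (_⊕ c) (⊕-comm a b))))
            (sym (cong₂ _xor_ ac bc))
          (inj₂ bc) → trans (realize-N q Na Nb Nc Nd true true true
              λ q fa fb fc ab′ ac′ bc′ → ≢false λ fd →
                claw-111 q (trans ab′ fab) (trans ac′ ac) (trans bc′ bc) fa fb fc fd)
            (sym (cong₂ _xor_ ac bc))

      Zr : V n → Set
      Zr w = U w × f w ≡ false

      -- A claw on a, b, c excludes the value 0, because then f vanishes on all lines by constant-value.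
      fourth-value : ∀ {a b c} → Quad a b c → N a → N b → N c → Constant ((a ⊕ b) ⊕ c) →
        f ((a ⊕ b) ⊕ c) ≡ true
      fourth-value {a} {b} {c} q Na Nb Nc cd = ≢false λ fd →
        let ¬Ud = Quad.¬Uc (quad-fourth q)
            on-line : ∀ {t} → N t → f (t ⊕ ((a ⊕ b) ⊕ c)) ≡ false
            on-line Nt = trans (sym (value Nt ¬Ud cd)) fd
        in realize q cd (takes Na true) (takes Nb true) (takes Nc true)
          λ q fa fb fc fd′ ab ac bc → claw-111 q
            (trans ab (tr (on-line Nc) (solve 3 (λ c a b → c :+ ((a :+ b) :+ c) ⊜ a :+ b) refl c a b)))
            (trans ac (tr (on-line Nb) (solve 3 (λ b a c → b :+ ((a :+ b) :+ c) ⊜ a :+ c) refl b a c)))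
            (trans bc (tr (on-line Na) (solve 3 (λ a b c → a :+ ((a :+ b) :+ c) ⊜ b :+ c) refl a b c)))
            fa fb fc (trans fd′ fd)

      ¬N⇒constant : ∀ {b} → ¬ U b → ¬ N b → Constant b
      ¬N⇒constant ¬Ub ¬Nb = case N? ¬Ub of λ where
        (inj₁ c) → c
        (inj₂ Nb) → ⊥-elim (¬Nb Nb)

      -- If a zero `w` off `W` moves one member of `N` out of `N`, it moves every member out, by
      -- `fourth-value`. This property passes from `w` to `w ⊕ y` for every difference `y` from `a`;
      -- as these span `U`, it would reach `w ⊕ w`, which lies in `W`.
      N-⊕zero : ∀ {w b} → Zr w → N b → N (b ⊕ w)
      N-⊕zero {w} {b} (Uw , fw) Nb = case W? w of λ where
          (inj₁ Ww) → N-~ (~-shift ~-refl Ww) Nb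
          (inj₂ ¬Ww) → case N? (¬U-⊕ (proj₁ Nb) Uw) of λ where
            (inj₂ Nbw) → Nbw
            (inj₁ c) → ⊥-elim (Y-spans Wu u≢0 fu Na Uw λ s →
              proj₁ (proj₂ (translate step s w (Uw , ¬Ww , fw , b , Nb , λ (_ , ¬c) → ¬c c))) ~-refl)
        where
        Moving : V n → Set
        Moving w = U w × ¬ W w × f w ≡ false × ∃ λ b → N b × ¬ N (b ⊕ w)
        all-moved : ∀ {w} → Moving w → ∀ {c} → N c → ¬ N (c ⊕ w)
        all-moved {w} (Uw , ¬Ww , fw , b , Nb , ¬Nbw) {c} Nc Ncw =
          true≢ (tr (fourth-value q Nb Nc Ncw (subst Constant d≡ cbw)) (sym d≡))
            (trans (value Nb ¬Ubw cbw) (tr fw (sym (cancelˡ b w))))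
          where
          ¬Ubw = ¬U-⊕ (proj₁ Nb) Uw
          cbw = ¬N⇒constant ¬Ubw ¬Nbw
          d≡ = (solve 3 (λ b w c → b :+ w ⊜ (b :+ c) :+ (c :+ w)) refl b w c)
          q : Quad b c (c ⊕ w)
          q = quad (proj₁ Nb) (proj₁ Nc) (proj₁ Ncw)
            (λ h → ¬Nbw (N-~ (subst W (solve 3 (λ b c w → b :+ c ⊜ (c :+ w) :+ (b :+ w)) refl b c w) h) Ncw))
            (λ h → ¬Nbw (N-~ (subst W (solve 3 (λ b c w → b :+ (c :+ w) ⊜ c :+ (b :+ w)) refl b c w) h) Nc))
            (λ h → ¬Ww (subst W (cancelˡ c w) h))
        step : ∀ w y → N (a ⊕ y) → Moving w → Moving (w ⊕ y)
        step w y Nay m@(Uw , ¬Ww , fw , _) =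
          U.⊕∈ Uw (Y⊆U Wu u≢0 fu Na y Nay) ,
          (λ h → ¬Naw (N-~ (subst W (solve 3 (λ w y a → w :+ y ⊜ (a :+ y) :+ (a :+ w)) refl w y a) h) Nay)) ,
          trans (trans (cong f (solve 3 (λ w y a → w :+ y ⊜ (a :+ y) :+ (a :+ w)) refl w y a))
              (sym (value Nay ¬Uaw caw)))
            (trans (value Na ¬Uaw caw) (tr fw (sym (cancelˡ a w)))) ,
          a ⊕ y , Nay , λ h → ¬Naw (subst N (solve 3 (λ a y w → (a :+ y) :+ (w :+ y) ⊜ a :+ w) refl a y w) h)
          where
          ¬Naw = all-moved m Na
          ¬Uaw = ¬U-⊕ ¬Ua Uw
          caw = ¬N⇒constant ¬Uaw ¬Naw

      -- In general position this is `parity-line` for `b`, `b ⊕ w`, `b ⊕ d`, whose first line has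
      -- the value `f w`, a zero. The other cases are those where `w`, `d` or `d ⊕ w` lies in `W`
      -- and cosets coincide.
      ∂-difference : ∀ {w d b} → Zr w → U d → N b → N (b ⊕ d) →
        ∂ f w b xor ∂ f w (b ⊕ d) ≡ f d xor f (d ⊕ w)
      ∂-difference {w} {d} {b} zw@(Uw , fw) Ud Nb Nbd = case W? w of λ where
          (inj₁ Ww) → case W≡ Ww of λ where
            (inj₁ refl) → trans (cong₂ _xor_ (∂0 b) (∂0 (b ⊕ d))) (sym (∂0 d))
            (inj₂ refl) → trans (cong₂ _xor_ (∂u Nb) (∂u Nbd)) (sym (f-⊕u-xor Ud))
          (inj₂ ¬Ww) → case W? d of λ where
            (inj₁ Wd) → case W≡ Wd of λ where
              (inj₁ refl) → trans (trans (cong (λ t → ∂ f w b xor ∂ f w t) (⊕-identityʳ b))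
                  (xor-same (∂ f w b)))
                (sym (cong₂ _xor_ f0 (tr fw (sym (⊕-identityˡ w)))))
              (inj₂ refl) → trans (trans (cong (∂ f w b xor_) (∂-⊕u Nb)) (xor-same (∂ f w b)))
                (sym (cong₂ _xor_ fu (tr (trans (f-⊕u Uw) fw) (⊕-comm w u))))
            (inj₂ ¬Wd) → case W? (d ⊕ w) of λ where
              (inj₁ Wdw) → case ~-cases (~-sym Wdw) of λ where
                (inj₁ refl) → trans (trans (cong (λ t → ∂ f w b xor (f (b ⊕ w) xor f t)) (cancelʳ b w))
                    (xor-flip-return (f b) _)) (sym (cong₂ _xor_ fw (tr f0 (sym (⊕-self w)))))
                (inj₂ refl) → trans (trans (cong (∂ f w b xor_)
                      (trans (cong₂ _xor_
                          (trans (cong f (solve 3 (λ b w u → b :+ (w :+ u) ⊜ (b :+ w) :+ u) refl b w u))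
                              (flip (N-⊕zero zw Nb)))
                          (trans (cong f (solve 3 (λ b w u → (b :+ (w :+ u)) :+ w ⊜ b :+ u) refl b w u))
                              (flip Nb)))
                        (xor-annihilates-not (f (b ⊕ w)) (f b))))
                    (xor-flip-return (f b) _))
                  (sym (cong₂ _xor_ (trans (f-⊕u Uw) fw)
                      (tr fu (solve 2 (λ u w → u ⊜ (w :+ u) :+ w) refl u w))))
              (inj₂ ¬Wdw) →
                let d≡ = (solve 3 (λ b d w → (b :+ d) :+ w ⊜ (b :+ (b :+ w)) :+ (b :+ d)) refl b d w)
                    wd≡ = (solve 3 (λ d w b → d :+ w ⊜ (b :+ w) :+ (b :+ d)) refl d w b)
                in begin
                  ∂ f w b xor ∂ f w (b ⊕ d) ≡⟨ xor-regroup (f b) _ _ _ ⟨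
                  (f b xor f ((b ⊕ d) ⊕ w)) xor (f (b ⊕ w) xor f (b ⊕ d))
                    ≡⟨ cong (λ t → (f b xor f t) xor (f (b ⊕ w) xor f (b ⊕ d))) d≡ ⟩
                  parity b (b ⊕ w) (b ⊕ d)
                    ≡⟨ parity-line
                         (quad (proj₁ Nb) (¬U-⊕ (proj₁ Nb) Uw) (proj₁ Nbd)
                           (λ h → ¬Ww (subst W (cancelˡ b w) h)) (λ h → ¬Wd (subst W (cancelˡ b d) h))
                           (λ h → ¬Wdw (subst W (sym wd≡) h)))
                         Nb (N-⊕zero zw Nb) Nbd (subst N d≡ (N-⊕zero zw Nbd)) (tr fw (sym (cancelˡ b w))) ⟩
                  f (b ⊕ (b ⊕ d)) xor f ((b ⊕ w) ⊕ (b ⊕ d))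
                    ≡⟨ cong₂ _xor_ (cong f (cancelˡ b d)) (cong f (sym wd≡)) ⟩
                  f d xor f (d ⊕ w) ∎
        where
        open ≡-Reasoning
        ∂0 : ∀ x → ∂ f 0v x ≡ false
        ∂0 x = trans (cong (f x xor_) (cong f (⊕-identityʳ x))) (xor-same (f x))
        ∂u : ∀ {x} → N x → ∂ f u x ≡ true
        ∂u {x} Nx = trans (cong (f x xor_) (flip Nx)) (xor-not (f x))
          where
          xor-not : ∀ b → b xor not b ≡ true
          xor-not true = refl
          xor-not false = refl
        f-⊕u-xor : ∀ {x} → U x → f x xor f (x ⊕ u) ≡ false
        f-⊕u-xor {x} Ux = trans (cong (f x xor_) (f-⊕u Ux)) (xor-same (f x))
        ∂-⊕u : ∀ {x} → N x → ∂ f w (x ⊕ u) ≡ ∂ f w x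
        ∂-⊕u {x} Nx = trans (cong₂ _xor_ (flip Nx)
          (trans (cong f (solve 3 (λ x u w → (x :+ u) :+ w ⊜ (x :+ w) :+ u) refl x u w))
              (flip (N-⊕zero zw Nx))))
          (xor-annihilates-not (f x) (f (x ⊕ w)))

      R : V n → Set
      R = Span Zr

      module R = Subspace (span-subspace Zr)

      R⊆U : ∀ {x} → R x → U x
      R⊆U = span-⊆ U≤ (λ _ → proj₁)

      N-⊕R : ∀ {r b} → R r → N b → N (b ⊕ r)
      N-⊕R Rr Nb = translate {P = N} (λ x w zw Nx → N-⊕zero zw Nx) Rr _ Nb

      ∂-⊕ : ∀ r s b → ∂ f (r ⊕ s) b ≡ ∂ f r b xor ∂ f s (b ⊕ r)
      ∂-⊕ r s b = trans (cong (f b xor_) (cong f (sym (⊕-assoc b r s)))) (sym (xor-telescope (f b) _ _))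

      -- The zeros span `U`: `f` is quadratic

      module _ (R-all : ∀ {x} → U x → ¬ ¬ R x) where

        all-N : ∀ {b} → ¬ U b → N b
        all-N {b} ¬Ub = ¬Ub , λ c → R-all (hyper ¬Ua ¬Ub) λ r →
          proj₂ (subst N (cancelˡ a b) (N-⊕R r Na)) c

        -- The second difference in directions `x`, `y` is the same at every point off `U` as at
        -- `0v`.
        Polar : V n → Set
        Polar x = ∀ {y b} → U y → ¬ U b → ∂ f x b xor ∂ f x (b ⊕ y) ≡ pol f x y

        -- `Δ f x y z` is the sum of the polarisations of `x` with `z`, `y` and `z ⊕ y`. Moved off
        -- `U` to the base points `a`, `a ⊕ z` and `a`, they telescope to zero.
        Δ-U : ∀ {x y z} → Polar x → U y → U z → Δ f x y z ≡ false
        Δ-U {x} {y} {z} Px Uy Uz = begin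
          Δ f x y z
            ≡⟨ cong₂ (λ s t → pol f x y xor ((f z xor f s) xor (f (z ⊕ y) xor f t)))
                 (⊕-comm z x) (⊕-comm (z ⊕ y) x) ⟩
          pol f x y xor ((f z xor f (x ⊕ z)) xor (f (z ⊕ y) xor f (x ⊕ (z ⊕ y))))
            ≡⟨ ⊻.solve 6 (λ t p q r s v → t ⊻.:+ ((q ⊻.:+ r) ⊻.:+ (s ⊻.:+ v)) ⊻.:=
                 (((p ⊻.:+ q) ⊻.:+ r) ⊻.:+ t) ⊻.:+ ((p ⊻.:+ s) ⊻.:+ v)) refl
                 (pol f x y) (f x) (f z) (f (x ⊕ z)) (f (z ⊕ y)) (f (x ⊕ (z ⊕ y))) ⟩
          (pol f x z xor pol f x y) xor pol f x (z ⊕ y)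
            ≡⟨ cong₂ _xor_ (cong₂ _xor_ (Px Uz ¬Ua) (Px Uy (¬U-⊕ ¬Ua Uz))) (Px (U.⊕∈ Uz Uy) ¬Ua) ⟨
          ((∂ f x a xor ∂ f x (a ⊕ z)) xor (∂ f x (a ⊕ z) xor ∂ f x ((a ⊕ z) ⊕ y)))
            xor (∂ f x a xor ∂ f x (a ⊕ (z ⊕ y)))
            ≡⟨ cong₂ _xor_ (xor-telescope (∂ f x a) _ _)
                 (cong (λ t → ∂ f x a xor ∂ f x t) (sym (⊕-assoc a z y))) ⟩
          (∂ f x a xor ∂ f x ((a ⊕ z) ⊕ y)) xor (∂ f x a xor ∂ f x ((a ⊕ z) ⊕ y)) ≡⟨ xor-same
              (∂ f x a xor ∂ f x ((a ⊕ z) ⊕ y)) ⟩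
          false ∎
          where open ≡-Reasoning

        polar-subspace : Subspace (λ x → U x × Polar x)
        polar-subspace = subspace (U.0∈ , polar0) λ (Ux , Px) (Ux′ , Px′) → U.⊕∈ Ux Ux′ , polar⊕ Ux Px Ux′ Px′
          where
          open ≡-Reasoning
          polar0 : Polar 0v
          polar0 {y} {b} Uy ¬Ub = begin
            ∂ f 0v b xor ∂ f 0v (b ⊕ y)
              ≡⟨ cong₂ (λ s t → (f b xor f s) xor (f (b ⊕ y) xor f t)) (⊕-identityʳ b) (⊕-identityʳ (b ⊕ y)) ⟩
            (f b xor f b) xor (f (b ⊕ y) xor f (b ⊕ y)) ≡⟨ cong₂ _xor_ (xor-same (f b)) (xor-same (f (b ⊕ y))) ⟩
            false ≡⟨ xor-same (f y) ⟨
            f y xor f y ≡⟨ cong₂ (λ s t → (s xor f y) xor f t) f0 (⊕-identityˡ y) ⟨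
            pol f 0v y ∎
          polar⊕ : ∀ {x x′} → U x → Polar x → U x′ → Polar x′ → Polar (x ⊕ x′)
          polar⊕ {x} {x′} Ux Px Ux′ Px′ {y} {b} Uy ¬Ub = begin
            ∂ f (x ⊕ x′) b xor ∂ f (x ⊕ x′) (b ⊕ y)
              ≡⟨ cong₂ _xor_ (∂-⊕ x x′ b) (trans (∂-⊕ x x′ (b ⊕ y))
                   (cong (λ t → ∂ f x (b ⊕ y) xor ∂ f x′ t)
                       (solve 3 (λ b y x → (b :+ y) :+ x ⊜ (b :+ x) :+ y) refl b y x))) ⟩
            (∂ f x b xor ∂ f x′ (b ⊕ x)) xor (∂ f x (b ⊕ y) xor ∂ f x′ ((b ⊕ x) ⊕ y))
              ≡⟨ ⊻.solve 4 (λ p q r s → (p ⊻.:+ q) ⊻.:+ (r ⊻.:+ s) ⊻.:= (p ⊻.:+ r) ⊻.:+ (q ⊻.:+ s)) refl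
                   (∂ f x b) (∂ f x′ (b ⊕ x)) (∂ f x (b ⊕ y)) (∂ f x′ ((b ⊕ x) ⊕ y)) ⟩
            (∂ f x b xor ∂ f x (b ⊕ y)) xor (∂ f x′ (b ⊕ x) xor ∂ f x′ ((b ⊕ x) ⊕ y))
              ≡⟨ cong₂ _xor_ (Px Uy ¬Ub) (Px′ Uy (¬U-⊕ ¬Ub Ux)) ⟩
            pol f x y xor pol f x′ y ≡⟨ xor≡false pol-additive ⟩
            pol f (x ⊕ x′) y ∎
            where
            -- The defect of additivity is `Δ f x y x′`.
            pol-additive : (pol f x y xor pol f x′ y) xor pol f (x ⊕ x′) y ≡ false
            pol-additive = begin
              (pol f x y xor pol f x′ y) xor pol f (x ⊕ x′) y
                ≡⟨ cong (λ t → ((((f x xor f y) xor f (x ⊕ y)) xor ((f x′ xor f y) xor f (x′ ⊕ y)))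
                     xor ((f (x ⊕ x′) xor f y) xor f t)))
                         (solve 3 (λ x x′ y → (x :+ x′) :+ y ⊜ (x′ :+ y) :+ x) refl x x′ y) ⟩
              _ ≡⟨ cong (λ t → ((((f x xor f y) xor f (x ⊕ y)) xor ((f x′ xor f y) xor f (x′ ⊕ y)))
                     xor ((f t xor f y) xor f ((x′ ⊕ y) ⊕ x)))) (⊕-comm x x′) ⟩
              _ ≡⟨ ⊻.solve 7 (λ p q r s t v w →
                     (((p ⊻.:+ q) ⊻.:+ r) ⊻.:+ ((s ⊻.:+ q) ⊻.:+ v)) ⊻.:+ ((t ⊻.:+ q) ⊻.:+ w) ⊻.:=
                     ((p ⊻.:+ q) ⊻.:+ r) ⊻.:+ ((s ⊻.:+ t) ⊻.:+ (v ⊻.:+ w))) refl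
                     (f x) (f y) (f (x ⊕ y)) (f x′) (f (x′ ⊕ x)) (f (x′ ⊕ y)) (f ((x′ ⊕ y) ⊕ x)) ⟩
              Δ f x y x′ ≡⟨ Δ-U Px Uy Ux′ ⟩
              false ∎

        polar : ∀ {x} → U x → Polar x
        polar {x} Ux {y} {b} Uy ¬Ub = stable λ ne → R-all Ux λ Rx →
          ne (proj₂ (span-⊆ polar-subspace (λ w zw@(Uw , fw) → Uw , λ {y} {b} Uy ¬Ub →
            trans (∂-difference zw Uy (all-N ¬Ub) (all-N (¬U-⊕ ¬Ub Uy)))
              (cong₂ (λ s t → (s xor f y) xor f t) (sym fw) (⊕-comm y w))) Rx) Uy ¬Ub)

        -- Adding `z` to `x` or `y` leaves `Δ` unchanged and brings either of them into `U`, where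
        -- `polar` applies.
        Δ-off-U : ∀ {x y z} → ¬ U z → Δ f x y z ≡ false
        Δ-off-U {x} {y} {z} ¬Uz = stable λ ne → by-cases (U x)
            (λ Ux → by-cases (U y) (λ Uy → ne (both Ux Uy)) (λ ¬Uy → ne (second Ux ¬Uy)))
            (λ ¬Ux → by-cases (U y)
              (λ Uy → ne (trans (sym (Δ-shift f x y z)) (both (hyper ¬Ux ¬Uz) Uy)))
              (λ ¬Uy → ne (trans (sym (Δ-shift f x y z)) (second (hyper ¬Ux ¬Uz) ¬Uy))))
          where
          both : ∀ {x y} → U x → U y → Δ f x y z ≡ false
          both {x} {y} Ux Uy = trans (cong (pol f x y xor_) (polar Ux Uy ¬Uz)) (xor-same (pol f x y))
          second : ∀ {x y} → U x → ¬ U y → Δ f x y z ≡ false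
          second {x} {y} Ux ¬Uy = begin
            Δ f x y z ≡⟨ Δ-swap₁₂ f x y z ⟩
            Δ f y x z ≡⟨ Δ-shift f y x z ⟨
            Δ f (y ⊕ z) x z ≡⟨ Δ-swap₁₂ f (y ⊕ z) x z ⟩
            Δ f x (y ⊕ z) z ≡⟨ both Ux (hyper ¬Uy ¬Uz) ⟩
            false ∎
            where open ≡-Reasoning

        quadratic : ∀ x y z → Δ f x y z ≡ false
        quadratic x y z = stable λ ne → by-cases (U z)
          (λ Uz → by-cases (U y)
            (λ Uy → by-cases (U x)
              (λ Ux → ne (Δ-U (polar Ux) Uy Uz))
              (λ ¬Ux → ne (trans (Δ-swap₁₂ f x y z) (trans (Δ-swap f y x z) (Δ-off-U ¬Ux)))))
            (λ ¬Uy → ne (trans (Δ-swap f x y z) (Δ-off-U ¬Uy))))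
          (λ ¬Uz → ne (Δ-off-U ¬Uz))

      -- The zeros span a proper subspace `R` of `U`

      module _ {d₀ : V n} (Ud₀ : U d₀) (¬Rd₀ : ¬ R d₀) where

        off-R : ∀ {x} → U x → ¬ R x → f x ≡ true
        off-R Ux ¬Rx = ≢false λ fx → ¬Rx (generator (Ux , fx))

        all-triangle-free : (∀ {w} → Zr w → ¬ W w → ⊥) → TriangleFreeComplement f
        all-triangle-free none = triangle-free Wu u≢0 fu Na
          (λ Ux ¬Wx → ≢false λ fx → none (Ux , fx) ¬Wx)
          λ Nt Wv v≢0 fv t~b fb fbv → case W≡ Wv of λ where
            (inj₁ e) → v≢0 e
            (inj₂ refl) → true≢ (trans (flip (N-~ t~b Nt)) (cong not fb)) fbv

        ∂-constant-off-R : ∀ {w b c} → Zr w → N b → N c → ¬ R (b ⊕ c) → ∂ f w b ≡ ∂ f w c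
        ∂-constant-off-R {w} {b} {c} zw Nb Nc ¬R = xor≡false (trans
          (cong (λ t → ∂ f w b xor ∂ f w t) (sym (cancelˡ b c)))
          (trans (∂-difference zw Ubc Nb (subst N (sym (cancelˡ b c)) Nc))
            (cong₂ _xor_ (off-R Ubc ¬R) (off-R (U.⊕∈ Ubc (proj₁ zw)) (λ h → ¬R (R.⊕∈⁻ʳ (generator zw) h))))))
          where Ubc = hyper (proj₁ Nb) (proj₁ Nc)

        -- If `b ⊕ c` lies in `R`, the comparison goes through some `b ⊕ y` in `N` with `y` off `R`.
        -- One exists because the differences from `b` span `U`, which contains `d₀`.
        ∂-constant : ∀ {w} → Zr w → ∀ {b c} → N b → N c → ∂ f w b ≡ ∂ f w c
        ∂-constant {w} zw {b} {c} Nb Nc = stable λ ne → by-cases (R (b ⊕ c))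
          (λ Rbc → Y-spans Wu u≢0 fu Nb Ud₀ λ s → span-⊆ (¬¬-subspace (span-subspace Zr))
            (λ y Nby ¬Ry →
              let ¬Rbe = λ h → ¬Ry (subst R (cancelˡ b y) h)
                  ¬Rce = λ h → ¬Rbe (subst R (solve 3 (λ b c y → (b :+ c) :+ (c :+ (b :+ y)) ⊜ b :+ (b :+ y))
                      refl b c y) (R.⊕∈ Rbc h))
              in ne (trans (∂-constant-off-R zw Nb Nby ¬Rbe) (sym (∂-constant-off-R zw Nc Nby ¬Rce))))
            s ¬Rd₀)
          (λ ¬Rbc → ne (∂-constant-off-R zw Nb Nc ¬Rbc))

        ∂-constant-R : ∀ {r} → R r → ∀ {b c} → N b → N c → ∂ f r b ≡ ∂ f r c
        ∂-constant-R [] {b} {c} Nb Nc = trans (∂0 b) (sym (∂0 c))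
          where
          ∂0 : ∀ x → ∂ f 0v x ≡ false
          ∂0 x = trans (cong (f x xor_) (cong f (⊕-identityʳ x))) (xor-same (f x))
        ∂-constant-R (_∷_ {y} {x} zy Rx) {b} {c} Nb Nc = trans (∂-⊕ y x b) (trans
          (cong₂ _xor_ (∂-constant zy Nb Nc) (∂-constant-R Rx (N-⊕zero zy Nb) (N-⊕zero zy Nc)))
          (sym (∂-⊕ y x c)))

        -- Walking from `0v` by zeros `w` never changes the value, since `∂-difference` turns the
        -- constancy of `∂ f w` on `N` into `f d` being `f (d ⊕ w)`.
        zero-on-R : ∀ {r} → R r → f r ≡ false
        zero-on-R {r} Rr = tr (proj₂ (translate {P = λ x → R x × f x ≡ false}
          (λ { d w zw (Rd , fd) → R.⊕∈ Rd (generator zw) ,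
            trans (sym (xor≡false (trans (sym (∂-difference zw (R⊆U Rd) Na (N-⊕R Rd Na)))
              (trans (cong (∂ f w a xor_) (∂-constant zw (N-⊕R Rd Na) Na)) (xor-same (∂ f w a)))))) fd })
          Rr 0v (R.0∈ , f0))) (⊕-identityˡ r)

        -- R₀ lifts R / W to a complement of W in R.
        R₀ : V n → Set
        R₀ r = R r × f (a ⊕ r) ≡ f a

        R₀-fixes : ∀ {r b} → R₀ r → N b → f (b ⊕ r) ≡ f b
        R₀-fixes {r} {b} (Rr , e) Nb = sym (xor≡false (trans (∂-constant-R Rr Nb Na)
          (trans (cong (f a xor_) e) (xor-same (f a)))))

        R₀-subspace : Subspace R₀
        R₀-subspace = subspace (R.0∈ , cong f (⊕-identityʳ a)) λ {r} {s} (Rr , e) r₀@(Rs , _) →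
          R.⊕∈ Rr Rs , trans (cong f (sym (⊕-assoc a r s))) (trans (R₀-fixes r₀ (N-⊕R Rr Na)) e)

        -- `f` is false on `R`, true on the rest of `U`, and true on the constant cosets off `U`;
        -- adding elements of `R` preserves each of these regions. On `N` the claim is `R₀-fixes`.
        R₀-invariant : ∀ {x s} → ¬ R₀ x → R₀ s → f (x ⊕ s) ≡ f x
        R₀-invariant {x} {s} _ r₀@(Rs , _) = stable λ ne → by-cases (R x)
          (λ Rx → ne (trans (zero-on-R (R.⊕∈ Rx Rs)) (sym (zero-on-R Rx))))
          λ ¬Rx → by-cases (U x)
            (λ Ux → ne (trans (off-R (U.⊕∈ Ux (R⊆U Rs)) (λ h → ¬Rx (R.⊕∈⁻ʳ Rs h))) (sym (off-R Ux ¬Rx))))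
            λ ¬Ux → case N? ¬Ux of λ where
              (inj₂ Nx) → ne (R₀-fixes r₀ Nx)
              (inj₁ cx) → ne (trans (off-N (¬U-⊕ ¬Ux (R⊆U Rs))
                (λ h → proj₂ (subst N (cancelʳ x s) (N-⊕R Rs h)) cx)) (sym (off-N ¬Ux (λ h → proj₂ h cx))))
          where
          off-N : ∀ {b} → ¬ U b → ¬ N b → f b ≡ true
          off-N {b} ¬Ub ¬Nb = trans (value Na ¬Ub (¬N⇒constant ¬Ub ¬Nb))
            (off-R (hyper ¬Ua ¬Ub) (λ h → ¬Nb (subst N (cancelˡ a b) (N-⊕R h Na))))

        -- Adding `u` flips the value at `a ⊕ w`, so `w` or `w ⊕ u` is in `R₀`, which would then be
        -- a decomposer.
        zero-outside-W : ∀ {w} → Zr w → ¬ W w → ⊥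
        zero-outside-W {w} zw ¬Ww = case split (∂ f w a) of λ where
            (inj₂ e) → contra (generator zw , sym (xor≡false e)) ¬Ww
            (inj₁ t) → contra {w ⊕ u}
              (R.⊕∈ (generator zw) (generator (W⊆U Wu , fu)) ,
                trans (cong f (sym (⊕-assoc a w u))) (trans (flip (N-⊕zero zw Na)) (not-right t)))
              (λ h → ¬Ww (W.⊕∈⁻ʳ Wu h))
          where
          contra : ∀ {r} → R₀ r → ¬ W r → ⊥
          contra r₀ ¬Wr = no-decomposer R₀ R₀-subspace r₀ (λ { refl → ¬Wr W.0∈ })
            (λ (Ra , _) → ¬Ua (R⊆U Ra)) R₀-invariant
          not-right : ∀ {b c} → b xor c ≡ true → not c ≡ b
          not-right {true} e = e
          not-right {false} refl = refl

      conclusion : ¬ (∀ x y z → Δ f x y z ≡ false) → ¬ TriangleFreeComplement f → ⊥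
      conclusion ¬quadratic ¬free = by-cases (∃ λ d → U d × ¬ R d)
        (λ (d , Ud , ¬Rd) → ¬free (all-triangle-free Ud ¬Rd (zero-outside-W Ud ¬Rd)))
        (λ none → ¬quadratic (quadratic λ Ux ¬Rx → none (_ , Ux , ¬Rx)))

  -- Assembling the cases

  two-point : ∀ {q} → (∀ {w} → W w → w ≢ 0v → f w ≡ q) → ∀ {w} → W w → w ≡ 0v ⊎ w ≡ w₀
  two-point {q} const {w} Ww = case w ≟ᵛ 0v of λ where
      (yes e) → inj₁ e
      (no w≢0) → case w ≟ᵛ w₀ of λ where
        (yes e) → inj₂ e
        (no w≢w₀) → ⊥-elim (minimal (λ x → x ≡ 0v ⊎ x ≡ w₀) (pair-subspace w₀)
          (λ { (inj₁ refl) → W.0∈ ; (inj₂ refl) → Ww₀ }) (inj₂ refl) w₀≢0 Ww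
          (λ { (inj₁ e) → w≢0 e ; (inj₂ e) → w≢w₀ e })
          λ {v} {s} Wv ¬Pv Ps → trans
            (const (W.⊕∈ Wv (case Ps of λ { (inj₁ refl) → W.0∈ ; (inj₂ refl) → Ww₀ }))
              (λ e → ¬Pv (P.⊕∈⁻ʳ Ps (inj₁ e))))
            (sym (const Wv (¬Pv ∘ inj₁))))
    where module P = Subspace (pair-subspace w₀)

  impossible : ¬ (∀ x y z → Δ f x y z ≡ false) → ¬ TriangleFreeComplement f →
    ¬ (∃ λ S₁ → ∃ λ S₂ → IsPGSum f S₁ S₂) → ⊥
  impossible ¬quadratic ¬free ¬pg = by-cases (∃ N)
    (λ (a , Na) → by-cases (∃ λ o → W o × f o ≡ true)
      (λ (o , Wo , fo) → by-cases (∃ λ z → W z × z ≢ 0v × f z ≡ false)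
        (λ (z , Wz , z≢0 , fz) → by-cases (∃ λ b → ∃ λ c → ZeroPair b c)
          (λ (_ , _ , p) → ¬pg (pg-sum Wo fo Wz z≢0 fz p))
          (λ none → ¬free (without-zero-pairs Wz z≢0 fz Na (λ p → none (_ , _ , p)))))
        (λ none →
          let ones = λ {w} (Ww : W w) w≢0 → ≢false (λ e → none (w , Ww , w≢0 , e))
          in ¬free (TwoPoint.Ones.triangle-free-ones Ww₀ w₀≢0 (two-point ones) (ones Ww₀ w₀≢0) Na)))
      (λ none →
        let zeros = λ {w} (Ww : W w) (_ : w ≢ 0v) → ≢true (λ t → none (w , Ww , t))
        in TwoPoint.Zeros.conclusion Ww₀ w₀≢0 (two-point zeros) (zeros Ww₀ w₀≢0) Na ¬quadratic ¬free))
    (λ none → no-decomposer W W≤ Ww₀ w₀≢0 ¬Wx₀ λ {x} {s} ¬Wx Ws → stable λ ne → by-cases (U x)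
      (λ Ux → ne (inv Ux ¬Wx Ws))
      (λ ¬Ux → none (x , ¬Ux , λ c → ne (constant-⊕ c Ws refl))))

isYes⁺ : ∀ {P : Set} (d : Dec P) → P → isYes d ≡ true
isYes⁺ (yes _) p = refl
isYes⁺ (no ¬p) p = ⊥-elim (¬p p)

isYes⁻ : ∀ {P : Set} (d : Dec P) → isYes d ≡ true → P
isYes⁻ (yes p) _ = p

isYes-false : ∀ {P : Set} (d : Dec P) → ¬ P → isYes d ≡ false
isYes-false d ¬p = ≢true (¬p ∘ isYes⁻ d)

-- Finite search and counting

all-V? : ∀ {n} {P : V n → Set} → (∀ x → Dec (P x)) → Dec (∀ x → P x)
all-V? {zero} P? = map′ (λ { p [] → p }) (λ h → h []) (P? [])
all-V? {suc n} P? = map′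
  (λ { (p , q) (false ∷ x) → p x ; (p , q) (true ∷ x) → q x })
  (λ h → h ∘ (false ∷_) , h ∘ (true ∷_))
  (all-V? (P? ∘ (false ∷_)) ×-dec all-V? (P? ∘ (true ∷_)))

any-V? : ∀ {n} {P : V n → Set} → (∀ x → Dec (P x)) → Dec (∃ P)
any-V? {zero} P? = map′ ([] ,_) (λ { ([] , p) → p }) (P? [])
any-V? {suc n} P? = map′
  (λ { (inj₁ (x , p)) → false ∷ x , p ; (inj₂ (x , p)) → true ∷ x , p })
  (λ { (false ∷ x , p) → inj₁ (x , p) ; (true ∷ x , p) → inj₂ (x , p) })
  (any-V? (P? ∘ (false ∷_)) ⊎-dec any-V? (P? ∘ (true ∷_)))

join : ∀ {n} → Sub n → Sub n → Sub (suc n)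
join S S′ (false ∷ x) = S x
join S S′ (true ∷ x) = S′ x

-- One function for each truth table, so a subset occurs here only up to pointwise equality; `reify`
-- supplies the listed representative.
all-Sub : ∀ n → List (Sub n)
all-Sub zero = (λ _ → false) ∷ˡ (λ _ → true) ∷ˡ []ˡ
all-Sub (suc n) = cartesianProductWith join (all-Sub n) (all-Sub n)

-- Excluded middle for the finitely many points, as a double negation.
reify : ∀ {n} (K : V n → Set) → ((S : Sub n) → S ∈ˡ all-Sub n →
  (∀ {x} → S ∋ x → K x) → (∀ {x} → K x → S ∋ x) → ⊥) → ⊥
reify {zero} K k = by-cases (K [])
  (λ p → k (λ _ → true) (there (here refl)) (λ { {[]} _ → p }) (λ _ → refl))
  (λ ¬p → k (λ _ → false) (here refl) (λ ()) (λ { {[]} p → ⊥-elim (¬p p) }))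
reify {suc n} K k = reify (K ∘ (false ∷_)) λ S S∈ S⁻ S⁺ → reify (K ∘ (true ∷_)) λ S′ S′∈ S′⁻ S′⁺ →
  k (join S S′) (∈-cartesianProductWith⁺ join S∈ S′∈)
    (λ { {false ∷ x} → S⁻ ; {true ∷ x} → S′⁻ }) (λ { {false ∷ x} → S⁺ ; {true ∷ x} → S′⁺ })

∈-allVecs : ∀ {n} (x : V n) → x ∈ˡ allVecs n
∈-allVecs [] = here refl
∈-allVecs (false ∷ x) = ∈-++⁺ˡ (∈-map⁺ (false ∷_) (∈-allVecs x))
∈-allVecs {suc n} (true ∷ x) = ∈-++⁺ʳ (map (false ∷_) (allVecs n)) (∈-map⁺ (true ∷_) (∈-allVecs x))

countL-≤ : ∀ {n} {S S′ : Sub n} → (∀ {x} → S ∋ x → S′ ∋ x) → ∀ xs → countL S xs ≤ countL S′ xs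
countL-≤ S⊆ []ˡ = z≤n
countL-≤ {S = S} {S′} S⊆ (x ∷ˡ xs) with S x in e | S′ x in e′
... | true | true = s≤s (countL-≤ S⊆ xs)
... | true | false = ⊥-elim (true≢ (S⊆ e) e′)
... | false | true = m≤n⇒m≤1+n (countL-≤ S⊆ xs)
... | false | false = countL-≤ S⊆ xs

countL-< : ∀ {n} {S S′ : Sub n} → (∀ {x} → S ∋ x → S′ ∋ x) →
  ∀ {w} → S w ≡ false → S′ ∋ w → ∀ {xs} → w ∈ˡ xs → countL S xs < countL S′ xs
countL-< S⊆ Sw S′w {x ∷ˡ xs} (here refl) rewrite Sw | S′w = s≤s (countL-≤ S⊆ xs)
countL-< {S = S} {S′} S⊆ Sw S′w {x ∷ˡ xs} (there w∈) with S x in e | S′ x in e′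
... | true | true = s≤s (countL-< S⊆ Sw S′w w∈)
... | true | false = ⊥-elim (true≢ (S⊆ e) e′)
... | false | true = m≤n⇒m≤1+n (countL-< S⊆ Sw S′w w∈)
... | false | false = countL-< S⊆ Sw S′w w∈

odd : ℕ → Bool
odd zero = false
odd (suc k) = not (odd k)

odd-false⇒Even : ∀ k → odd k ≡ false → Even k
odd-false⇒Even zero _ = 0 , refl
odd-false⇒Even (suc (suc k)) e =
  let (j , k≡) = odd-false⇒Even k (trans (sym (not-involutive (odd k))) e)
  in suc j , cong suc (trans (cong suc k≡) (sym (+-suc j j)))

⨁ : ∀ {n} → Sub n → Bool
⨁ {zero} S = S []
⨁ {suc n} S = ⨁ (S ∘ (false ∷_)) xor ⨁ (S ∘ (true ∷_))

⨁-cong : ∀ {n} {S S′ : Sub n} → (∀ x → S x ≡ S′ x) → ⨁ S ≡ ⨁ S′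
⨁-cong {zero} h = h []
⨁-cong {suc n} h = cong₂ _xor_ (⨁-cong (h ∘ (false ∷_))) (⨁-cong (h ∘ (true ∷_)))

⨁-false : ∀ n → ⨁ {n} (λ _ → false) ≡ false
⨁-false zero = refl
⨁-false (suc n) = cong₂ _xor_ (⨁-false n) (⨁-false n)

⨁-xor : ∀ {n} (S S′ : Sub n) → ⨁ (λ x → S x xor S′ x) ≡ ⨁ S xor ⨁ S′
⨁-xor {zero} S S′ = refl
⨁-xor {suc n} S S′ = trans
  (cong₂ _xor_ (⨁-xor (S ∘ (false ∷_)) (S′ ∘ (false ∷_))) (⨁-xor (S ∘ (true ∷_)) (S′ ∘ (true ∷_))))
  (xor-interchange (⨁ (S ∘ (false ∷_))) (⨁ (S′ ∘ (false ∷_))) (⨁ (S ∘ (true ∷_))) (⨁ (S′ ∘ (true ∷_))))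

⨁-exchange : ∀ {n k} (g : V n → V k → Bool) → ⨁ (λ x → ⨁ (g x)) ≡ ⨁ (λ c → ⨁ (λ x → g x c))
⨁-exchange {zero} g = refl
⨁-exchange {suc n} g = trans
  (cong₂ _xor_ (⨁-exchange (g ∘ (false ∷_))) (⨁-exchange (g ∘ (true ∷_))))
  (sym (⨁-xor (λ c → ⨁ (λ x → g (false ∷ x) c)) (λ c → ⨁ (λ x → g (true ∷ x) c))))

⨁-singleton : ∀ {n} (g : Sub n) (δ : Sub n) (v : V n) → (∀ {x} → δ ∋ x → x ≡ v) → δ ∋ v →
  ⨁ (λ x → g x ∧ δ x) ≡ g v
⨁-singleton {zero} g δ [] _ δv = trans (cong (g [] ∧_) δv) (∧-identityʳ (g []))
⨁-singleton {suc n} g δ (b ∷ v) δ⁻ δv = head b δ⁻ δv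
  where
  vanish : ∀ b → (∀ x → δ (b ∷ x) ≡ false) → ⨁ (λ x → g (b ∷ x) ∧ δ (b ∷ x)) ≡ false
  vanish b h = trans (⨁-cong (λ x → trans (cong (g (b ∷ x) ∧_) (h x)) (∧-zeroʳ _))) (⨁-false n)
  half : ∀ b → (∀ {x} → δ ∋ x → x ≡ b ∷ v) → δ ∋ (b ∷ v) → ⨁ (λ x → g (b ∷ x) ∧ δ (b ∷ x)) ≡ g (b ∷ v)
  half b δ⁻ δv = ⨁-singleton (g ∘ (b ∷_)) (δ ∘ (b ∷_)) v (λ h → cong tail (δ⁻ h)) δv
  head : ∀ b → (∀ {x} → δ ∋ x → x ≡ b ∷ v) → δ ∋ (b ∷ v) → ⨁ (λ x → g x ∧ δ x) ≡ g (b ∷ v)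
  head false δ⁻ δv = trans (cong₂ _xor_ (half false δ⁻ δv)
    (vanish true (λ x → ≢true λ h → case δ⁻ h of λ ()))) (xor-identityʳ _)
  head true δ⁻ δv = cong₂ _xor_ (vanish false (λ x → ≢true λ h → case δ⁻ h of λ ())) (half true δ⁻ δv)

odd-countL-++ : ∀ {n} (S : Sub n) xs ys → odd (countL S (xs ++ ys)) ≡ odd (countL S xs) xor odd (countL S ys)
odd-countL-++ S []ˡ ys = refl
odd-countL-++ S (x ∷ˡ xs) ys with S x
... | true = trans (cong not (odd-countL-++ S xs ys)) (not-distribˡ-xor (odd (countL S xs)) _)
... | false = odd-countL-++ S xs ys

countL-map : ∀ {n k} (S : Sub n) (h : V k → V n) xs → countL S (map h xs) ≡ countL (S ∘ h) xs
countL-map S h []ˡ = refl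
countL-map S h (x ∷ˡ xs) with S (h x)
... | true = cong suc (countL-map S h xs)
... | false = countL-map S h xs

odd-card : ∀ {n} (S : Sub n) → odd (card S) ≡ ⨁ S
odd-card {zero} S with S []
... | true = refl
... | false = refl
odd-card {suc n} S = trans (odd-countL-++ S (map (false ∷_) (allVecs n)) (map (true ∷_) (allVecs n)))
  (cong₂ _xor_ (trans (cong odd (countL-map S (false ∷_) (allVecs n))) (odd-card (S ∘ (false ∷_))))
    (trans (cong odd (countL-map S (true ∷_) (allVecs n))) (odd-card (S ∘ (true ∷_)))))

lincomb-injective : ∀ {n k} {bs : Vec (V n) k} → LinIndep bs → ∀ {c d} → lincomb c bs ≡ lincomb d bs → c ≡ d
lincomb-injective {bs = bs} indep {c} {d} e = trans (sym (cancelʳ c d)) (trans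
  (cong (_⊕ d) (indep (c ⊕ d) (trans (lincomb-⊕ c d bs) (trans (cong (_⊕ lincomb d bs) e) (⊕-self _)))))
  (⊕-identityˡ d))

-- `E x ∧ P x` is expanded as a sum over the coefficient vectors that yield `x`, and the two sums
-- are exchanged. At `0v`, about which `IsBasisOf` says nothing, `E` is false.
⨁-flat : ∀ {n k} {E P : Sub n} {bs : Vec (V n) k} → IsMatroid E → IsBasisOf bs P →
  ⨁ (λ x → E x ∧ P x) ≡ ⨁ (λ c → E (lincomb c bs))
⨁-flat {n} {k} {E} {P} {bs} E0 (indep , spans) = begin
  ⨁ (λ x → E x ∧ P x) ≡⟨ ⨁-cong (sym ∘ expand) ⟩
  ⨁ (λ x → ⨁ (λ c → E x ∧ δ x c)) ≡⟨ ⨁-exchange (λ x c → E x ∧ δ x c) ⟩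
  ⨁ (λ c → ⨁ (λ x → E x ∧ δ x c))
    ≡⟨ ⨁-cong (λ c → ⨁-singleton E (λ x → δ x c) (lincomb c bs) (λ {x} h → sym (isYes⁻ (lincomb c bs ≟ᵛ x) h))
         (isYes⁺ (lincomb c bs ≟ᵛ lincomb c bs) refl)) ⟩
  ⨁ (λ c → E (lincomb c bs)) ∎
  where
  open ≡-Reasoning
  δ : V n → V k → Bool
  δ x c = isYes (lincomb c bs ≟ᵛ x)
  expand : ∀ x → ⨁ (λ c → E x ∧ δ x c) ≡ E x ∧ P x
  expand x with E x in Ex
  ... | false = ⨁-false k
  ... | true with P x in Px
  ... | true =
    let (c , e) = proj₁ (spans x (λ { refl → true≢ Ex E0 })) Px
    in ⨁-singleton (λ _ → true) (δ x) c
         (λ {d} h → lincomb-injective indep (trans (isYes⁻ (lincomb d bs ≟ᵛ x) h) (sym e)))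
         (isYes⁺ (lincomb c bs ≟ᵛ x) e)
  ... | false = trans (⨁-cong λ c → isYes-false (lincomb c bs ≟ᵛ x) λ e →
    true≢ (proj₂ (spans x (λ { refl → true≢ Ex E0 })) (c , e)) Px) (⨁-false k)

quadratic⇒EvenPlane : ∀ {n} {E : Sub n} → IsMatroid E → (∀ x y z → Δ E x y z ≡ false) → EvenPlane E
quadratic⇒EvenPlane {E = E} E0 quadratic P (_ , x ∷ y ∷ z ∷ [] , basis) =
  odd-false⇒Even _ (trans (odd-card (λ x → E x ∧ P x))
      (trans (⨁-flat {E = E} {P} E0 basis) (trans cube (quadratic x y z))))
  where
  -- The zero coefficient vector contributes `E 0v`; the other seven give the summands of `Δ`.
  cube : ⨁ (λ c → E (lincomb c (x ∷ y ∷ z ∷ []))) ≡ Δ E x y z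
  cube rewrite E0 | ⊕-identityʳ x | ⊕-identityʳ y | ⊕-identityʳ z | ⊕-comm y z | ⊕-comm x (z ⊕ y) | ⊕-comm x z =
    ⊻.solve 7 (λ p q r s t v w →
      (s ⊻.:+ (q ⊻.:+ v)) ⊻.:+ ((p ⊻.:+ t) ⊻.:+ (r ⊻.:+ w)) ⊻.:=
      ((p ⊻.:+ q) ⊻.:+ r) ⊻.:+ ((s ⊻.:+ t) ⊻.:+ (v ⊻.:+ w))) refl
      (E x) (E y) (E (x ⊕ y)) (E z) (E (z ⊕ x)) (E (z ⊕ y)) (E ((z ⊕ y) ⊕ x))

-- From flats to subspaces

0∪ : ∀ {n} → Sub n → V n → Set
0∪ F x = x ≡ 0v ⊎ F ∋ x

flat-subspace : ∀ {n} {F : Sub n} → IsFlat F → Subspace (0∪ F)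
flat-subspace {F = F} (_ , closed) = subspace (inj₁ refl) λ where
  (inj₁ refl) q → subst (0∪ F) (sym (⊕-identityˡ _)) q
  p@(inj₂ _) (inj₁ refl) → subst (0∪ F) (sym (⊕-identityʳ _)) p
  {x} {y} (inj₂ p) (inj₂ q) → case x ≟ᵛ y of λ where
    (yes refl) → inj₁ (⊕-self x)
    (no x≢y) → inj₂ (closed x y p q x≢y)

flat-≢0 : ∀ {n} {F : Sub n} → IsFlat F → ∀ {x} → F ∋ x → x ≢ 0v
flat-≢0 (F0 , _) Fx refl = true≢ Fx F0

Represents : ∀ {n} → Sub n → (V n → Set) → Set
Represents S K = (∀ {x} → S ∋ x → K x × x ≢ 0v) × (∀ {x} → K x × x ≢ 0v → S ∋ x)

represented-flat : ∀ {n} {S : Sub n} {K : V n → Set} → Represents S K → Subspace K → IsFlat S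
represented-flat (S⁻ , S⁺) K≤ = ≢true (λ h → proj₂ (S⁻ h) refl) , λ x y Sx Sy x≢y →
  S⁺ (Subspace.⊕∈ K≤ (proj₁ (S⁻ Sx)) (proj₁ (S⁻ Sy)) , ⊕≢0 x≢y)

decomposer-intro : ∀ {n} {E G S : Sub n} {K : V n → Set} → Represents S K → Subspace K →
  (∀ {x} → K x → x ≢ 0v → G ∋ x) → ∀ {x} → K x → x ≢ 0v → ∀ {y} → G ∋ y → ¬ K y →
  (∀ {x s} → G ∋ x → ¬ K x → K s → E (x ⊕ s) ≡ E x) → G 0v ≡ false → IsDecomposer E G S
decomposer-intro {E = E} {G} {S} {K} rep@(S⁻ , S⁺) K≤ K⊆G {x} Kx x≢0 {y} Gy ¬Ky invariant G0 =
    represented-flat rep K≤ , (λ x Sx → K⊆G (proj₁ (S⁻ Sx)) (proj₂ (S⁻ Sx))) ,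
    (x , S⁺ (Kx , x≢0)) , (y , Gy , ≢true (¬Ky ∘ proj₁ ∘ S⁻)) ,
    λ x Gx Sx (y , z , xy , xz , (Ey , _) , (_ , Ez)) →
      let ¬Kx = λ Kx → true≢ (S⁺ (Kx , λ { refl → true≢ Gx G0 })) Sx
      in true≢ Ey (trans (on-coset Gx ¬Kx xy) (trans (sym (on-coset Gx ¬Kx xz)) Ez))
  where
  on-coset : ∀ {x y} → G ∋ x → ¬ K x → InCoset S x y → E y ≡ E x
  on-coset {x} {y} Gx ¬Kx c = trans (cong E (sym (cancelˡ x y))) (invariant Gx ¬Kx (case c of λ where
    (inj₁ e) → subst K (sym e) (Subspace.0∈ K≤)
    (inj₂ Sxy) → proj₁ (S⁻ Sxy)))

decomposer-invariant : ∀ {n} {E H F : Sub n} → IsFlat H → IsDecomposer E H F →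
  ∀ {x w} → 0∪ H x → ¬ 0∪ F x → 0∪ F w → E (x ⊕ w) ≡ E x
decomposer-invariant {E = E} {H} {F} flatH (_ , F⊆H , _ , _ , unmixed) {x} {w} Ux ¬Wx Ww =
    stable λ ne → case split (E x) of λ where
      (inj₁ t) → unmixed x Hx Fx (x , x ⊕ w , inj₁ (⊕-self x) , shifted , (t , Hx) ,
        Hxw , ≢true (λ t′ → ne (trans t′ (sym t))))
      (inj₂ e) → unmixed x Hx Fx (x ⊕ w , x , shifted , inj₁ (⊕-self x) ,
        (≢false (λ e′ → ne (trans e′ (sym e))) , Hxw) , Hx , e)
  where
  H∋ : ∀ {x} → 0∪ H x → x ≢ 0v → H ∋ x
  H∋ (inj₁ e) x≢0 = ⊥-elim (x≢0 e)
  H∋ (inj₂ Hx) _ = Hx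
  Hx = H∋ Ux (¬Wx ∘ inj₁)
  Fx = ≢true (¬Wx ∘ inj₂)
  Hxw : H ∋ (x ⊕ w)
  Hxw = H∋ (Subspace.⊕∈ (flat-subspace flatH) Ux
      (case Ww of λ { (inj₁ e) → inj₁ e ; (inj₂ Fw) → inj₂ (F⊆H w Fw) }))
    (⊕≢0 λ { refl → ¬Wx Ww })
  shifted : InCoset F x (x ⊕ w)
  shifted = subst (0∪ F) (sym (cancelˡ x w)) Ww

no-claw : ∀ {n} {E : Sub n} → IsMatroid E → ClawFree E → ∀ a b c → a ≢ b → a ≢ c → b ≢ c →
  E a ≡ true → E b ≡ true → E c ≡ true →
  E (a ⊕ b) ≡ false → E (a ⊕ c) ≡ false → E (b ⊕ c) ≡ false → E ((a ⊕ b) ⊕ c) ≡ false → ⊥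
no-claw {n} {E} E0 free a b c a≢b a≢c b≢c Ea Eb Ec Eab Eac Ebc Eabc =
    free P ((flat , bs , basis) , bs , basis , λ x → E∩P⊆bs , bs⊆E∩P)
  where
  bs : Vec (V n) 3
  bs = a ∷ b ∷ c ∷ []
  P? : ∀ x → Dec (x ≢ 0v × InSpan bs x)
  P? x = ¬? (x ≟ᵛ 0v) ×-dec any-V? (λ c → lincomb c bs ≟ᵛ x)
  P : Sub n
  P x = isYes (P? x)
  flat : IsFlat P
  flat = isYes-false (P? 0v) (λ h → proj₁ h refl) , λ x y Px Py x≢y →
    let (_ , (c , ec)) = isYes⁻ (P? x) Px
        (_ , (d , ed)) = isYes⁻ (P? y) Py
    in isYes⁺ (P? (x ⊕ y)) (⊕≢0 x≢y , (c ⊕ d) , trans (lincomb-⊕ c d bs) (cong₂ _⊕_ ec ed))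
  E≢0 : ∀ {x} → E x ≡ true → x ≢ 0v
  E≢0 Ex refl = true≢ Ex E0
  indep : LinIndep bs
  indep (false ∷ false ∷ false ∷ []) e = refl
  indep (true ∷ false ∷ false ∷ []) e = ⊥-elim (E≢0 Ea (trans (sym (⊕-identityʳ a)) e))
  indep (false ∷ true ∷ false ∷ []) e = ⊥-elim (E≢0 Eb (trans (sym (⊕-identityʳ b)) e))
  indep (false ∷ false ∷ true ∷ []) e = ⊥-elim (E≢0 Ec (trans (sym (⊕-identityʳ c)) e))
  indep (true ∷ true ∷ false ∷ []) e = ⊥-elim (⊕≢0 a≢b
      (trans (solve 2 (λ a b → a :+ b ⊜ a :+ (b :+ :0)) refl a b) e))
  indep (true ∷ false ∷ true ∷ []) e = ⊥-elim (⊕≢0 a≢c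
      (trans (solve 2 (λ a c → a :+ c ⊜ a :+ (c :+ :0)) refl a c) e))
  indep (false ∷ true ∷ true ∷ []) e = ⊥-elim (⊕≢0 b≢c
      (trans (solve 2 (λ b c → b :+ c ⊜ b :+ (c :+ :0)) refl b c) e))
  indep (true ∷ true ∷ true ∷ []) e = ⊥-elim (⊕≢0 {a = a ⊕ b} {c} (λ { refl → true≢ Ec Eab })
    (trans (solve 3 (λ a b c → (a :+ b) :+ c ⊜ a :+ (b :+ (c :+ :0))) refl a b c) e))
  basis : IsBasisOf bs P
  basis = indep , λ x x≢0 → (λ Px → proj₂ (isYes⁻ (P? x) Px)) , (λ s → isYes⁺ (P? x) (x≢0 , s))
  outside : ∀ {x y} → E x ≡ false → x ≡ y → E y ≡ true → ⊥
  outside Ex refl Ey = true≢ Ey Ex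
  E∩P⊆bs : ∀ {x} → E ∋ x × P ∋ x → x ∈ bs
  E∩P⊆bs {x} (Ex , Px) = case isYes⁻ (P? x) Px of λ where
    (x≢0 , false ∷ false ∷ false ∷ [] , e) → ⊥-elim (x≢0 (sym e))
    (_ , true ∷ false ∷ false ∷ [] , e) → hereᵛ (trans (sym e) (⊕-identityʳ a))
    (_ , false ∷ true ∷ false ∷ [] , e) → thereᵛ (hereᵛ (trans (sym e) (⊕-identityʳ b)))
    (_ , false ∷ false ∷ true ∷ [] , e) → thereᵛ (thereᵛ (hereᵛ (trans (sym e) (⊕-identityʳ c))))
    (_ , true ∷ true ∷ false ∷ [] , e) → ⊥-elim
        (outside Eab (trans (solve 2 (λ a b → a :+ b ⊜ a :+ (b :+ :0)) refl a b) e) Ex)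
    (_ , true ∷ false ∷ true ∷ [] , e) → ⊥-elim
        (outside Eac (trans (solve 2 (λ a c → a :+ c ⊜ a :+ (c :+ :0)) refl a c) e) Ex)
    (_ , false ∷ true ∷ true ∷ [] , e) → ⊥-elim
        (outside Ebc (trans (solve 2 (λ b c → b :+ c ⊜ b :+ (c :+ :0)) refl b c) e) Ex)
    (_ , true ∷ true ∷ true ∷ [] , e) →
      ⊥-elim (outside Eabc (trans (solve 3 (λ a b c → (a :+ b) :+ c ⊜ a :+ (b :+ (c :+ :0))) refl a b c) e) Ex)
  bs⊆E∩P : ∀ {x} → x ∈ bs → E ∋ x × P ∋ x
  bs⊆E∩P (hereᵛ refl) = Ea , isYes⁺ (P? a) (E≢0 Ea , true ∷ false ∷ false ∷ [] , ⊕-identityʳ a)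
  bs⊆E∩P (thereᵛ (hereᵛ refl)) = Eb , isYes⁺ (P? b) (E≢0 Eb , false ∷ true ∷ false ∷ [] , ⊕-identityʳ b)
  bs⊆E∩P (thereᵛ (thereᵛ (hereᵛ refl))) =
    Ec , isYes⁺ (P? c) (E≢0 Ec , false ∷ false ∷ true ∷ [] , ⊕-identityʳ c)

-- Counting vectors: a hyperplane has only one other coset

bit : Bool → Fin 2
bit false = zero
bit true = suc zero

unbit : Fin 2 → Bool
unbit zero = false
unbit (suc zero) = true

unbit-injective : ∀ {i j} → unbit i ≡ unbit j → i ≡ j
unbit-injective {zero} {zero} _ = refl
unbit-injective {zero} {suc zero} ()
unbit-injective {suc zero} {zero} ()
unbit-injective {suc zero} {suc zero} _ = refl

encode : ∀ {n} → V n → Fin (2 ^ n)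
encode [] = zero
encode (b ∷ x) = combine (bit b) (encode x)

encode-injective : ∀ {n} (x y : V n) → encode x ≡ encode y → x ≡ y
encode-injective [] [] _ = refl
encode-injective (b ∷ x) (c ∷ y) e =
  let (b≡c , x≡y) = combine-injective (bit b) (encode x) (bit c) (encode y) e
  in cong₂ _∷_ (bit-injective b c b≡c) (encode-injective x y x≡y)
  where
  bit-injective : ∀ b c → bit b ≡ bit c → b ≡ c
  bit-injective false false _ = refl
  bit-injective true true _ = refl

decode : ∀ n → Fin (2 ^ n) → V n
decode zero _ = []
decode (suc n) i = unbit (proj₁ (remQuot {2} (2 ^ n) i)) ∷ decode n (proj₂ (remQuot {2} (2 ^ n) i))

decode-injective : ∀ n {i j} → decode n i ≡ decode n j → i ≡ j
decode-injective zero {zero} {zero} _ = refl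
decode-injective (suc n) {i} {j} e =
  let (b≡ , x≡) = ∷-injective e
  in trans (sym (combine-remQuot {2} (2 ^ n) i)) (trans
    (cong₂ combine (unbit-injective b≡) (decode-injective n x≡)) (combine-remQuot {2} (2 ^ n) j))

too-many-independent : ∀ {n} (bs : Vec (V n) (suc n)) → ¬ LinIndep bs
too-many-independent {n} bs indep =
  let (i , j , i<j , e) = pigeonhole (^-monoʳ-< 2 (s≤s (s≤s z≤n)) (n<1+n n))
        (λ i → encode (lincomb (decode (suc n) i) bs))
  in <⇒≢ i<j (decode-injective (suc n) (lincomb-injective indep (encode-injective _ _ e)))

-- If `a ⊕ b` were outside as well, `a` and `b` would extend the `m` basis vectors of `H` to `m + 2`
-- independent vectors in dimension `m + 1`.
hyperplane : ∀ {m} {H : Sub (suc m)} → IsFlatOfDim H m →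
  ∀ {a b} → ¬ 0∪ H a → ¬ 0∪ H b → 0∪ H (a ⊕ b)
hyperplane {m} {H} (flatH , bs , indep , spans) {a} {b} ¬Ua ¬Ub =
    case ((a ⊕ b) ≟ᵛ 0v) ⊎-dec (H (a ⊕ b) ≟ᵇ true) of λ where
      (yes Uab) → Uab
      (no ¬Uab) → ⊥-elim (too-many-independent (a ∷ b ∷ bs) (extended ¬Uab))
  where
  module U = Subspace (flat-subspace flatH)
  combination : ∀ c → 0∪ H (lincomb c bs)
  combination c = case lincomb c bs ≟ᵛ 0v of λ where
    (yes e) → inj₁ e
    (no ≢0) → inj₂ (proj₂ (spans _ ≢0) (c , refl))
  summand : ∀ {x} c → x ⊕ lincomb c bs ≡ 0v → 0∪ H x
  summand c e = U.⊕∈⁻ʳ (combination c) (inj₁ e)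
  extended : ¬ 0∪ H (a ⊕ b) → LinIndep (a ∷ b ∷ bs)
  extended ¬Uab (false ∷ false ∷ c) e = cong (λ d → false ∷ false ∷ d) (indep c e)
  extended ¬Uab (true ∷ false ∷ c) e = ⊥-elim (¬Ua (summand c e))
  extended ¬Uab (false ∷ true ∷ c) e = ⊥-elim (¬Ub (summand c e))
  extended ¬Uab (true ∷ true ∷ c) e = ⊥-elim (¬Uab (summand c (trans (⊕-assoc a b _) e)))

triangle-free-complement : ∀ {n} {E : Sub n} → TriangleFreeComplement E → ComplementTriangleFree E
triangle-free-complement {E = E} free T (_ , x ∷ y ∷ [] , indep , spans) missed =
    free x y x≢0 y≢0 x≢y (vanishes x≢0 (true ∷ false ∷ [] , ⊕-identityʳ x))
      (vanishes y≢0 (false ∷ true ∷ [] , ⊕-identityʳ y))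
      (vanishes (⊕≢0 x≢y) (true ∷ true ∷ [] , cong (x ⊕_) (⊕-identityʳ y)))
  where
  x≢0 : x ≢ 0v
  x≢0 e = case indep (true ∷ false ∷ []) (trans (⊕-identityʳ x) e) of λ ()
  y≢0 : y ≢ 0v
  y≢0 e = case indep (false ∷ true ∷ []) (trans (⊕-identityʳ y) e) of λ ()
  x≢y : x ≢ y
  x≢y refl = case indep (true ∷ true ∷ []) (trans (cong (x ⊕_) (⊕-identityʳ x)) (⊕-self x)) of λ ()
  vanishes : ∀ {z} → z ≢ 0v → InSpan (x ∷ y ∷ []) z → E z ≡ false
  vanishes {z} z≢0 s = proj₂ (missed z (proj₂ (spans z z≢0) s))

isZero-0v : ∀ n → isZero (0v {n}) ≡ true
isZero-0v zero = refl
isZero-0v (suc n) = isZero-0v n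

isZero⇒0v : ∀ {n} (x : V n) → isZero x ≡ true → x ≡ 0v
isZero⇒0v [] _ = refl
isZero⇒0v (false ∷ x) e = cong (false ∷_) (isZero⇒0v x e)

Gfull⁺ : ∀ {n} {x : V n} → x ≢ 0v → Gfull ∋ x
Gfull⁺ {x = x} x≢0 = cong not (≢true (x≢0 ∘ isZero⇒0v x))

Gfull-0v : ∀ {n} → Gfull (0v {n}) ≡ false
Gfull-0v {n} = cong not (isZero-0v n)

-- Deciding the outcomes

IsFlat? : ∀ {n} (F : Sub n) → Dec (IsFlat F)
IsFlat? F = (F 0v ≟ᵇ false) ×-dec all-V? (λ x → all-V? (λ y →
  (F x ≟ᵇ true) →-dec ((F y ≟ᵇ true) →-dec (¬? (x ≟ᵛ y) →-dec (F (x ⊕ y) ≟ᵇ true)))))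

InCoset? : ∀ {n} (F : Sub n) x y → Dec (InCoset F x y)
InCoset? F x y = ((x ⊕ y) ≟ᵛ 0v) ⊎-dec (F (x ⊕ y) ≟ᵇ true)

IsDecomposer? : ∀ {n} (E G F : Sub n) → Dec (IsDecomposer E G F)
IsDecomposer? E G F = IsFlat? F ×-dec (all-V? (λ x → (F x ≟ᵇ true) →-dec (G x ≟ᵇ true)) ×-dec
  (any-V? (λ x → F x ≟ᵇ true) ×-dec (any-V? (λ x → (G x ≟ᵇ true) ×-dec (F x ≟ᵇ false)) ×-dec
    all-V? (λ x → (G x ≟ᵇ true) →-dec ((F x ≟ᵇ false) →-dec ¬? (any-V? (λ y → any-V? (λ z →
      InCoset? F x y ×-dec (InCoset? F x z ×-dec
        (((E y ≟ᵇ true) ×-dec (G y ≟ᵇ true)) ×-dec ((G z ≟ᵇ true) ×-dec (E z ≟ᵇ false))))))))))))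

Splits : ∀ {n} → Sub n → Sub n → Sub n → Set
Splits E F₁ F₂ = IsFlat F₁ × IsFlat F₂ × (∀ x → E x ≡ (F₁ x ∨ F₂ x)) × (∀ x → F₁ ∋ x → F₂ x ≡ false)

Splits? : ∀ {n} (E F₁ F₂ : Sub n) → Dec (Splits E F₁ F₂)
Splits? E F₁ F₂ = IsFlat? F₁ ×-dec (IsFlat? F₂ ×-dec (all-V? (λ x → E x ≟ᵇ (F₁ x ∨ F₂ x)) ×-dec
  all-V? (λ x → (F₁ x ≟ᵇ true) →-dec (F₂ x ≟ᵇ false))))

splits : ∀ {n} {E F₁ F₂ : Sub n} {S₁ S₂} → IsMatroid E → IsPGSum E S₁ S₂ →
  Represents F₁ S₁ → Represents F₂ S₂ → Splits E F₁ F₂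
splits {E = E} {F₁} {F₂} E0 pg r₁@(F₁⁻ , F₁⁺) r₂@(F₂⁻ , F₂⁺) =
    represented-flat r₁ subspace₁ , represented-flat r₂ subspace₂ , union ,
    λ x F₁x → ≢true λ F₂x → proj₂ (F₁⁻ F₁x) (disjoint (proj₁ (F₁⁻ F₁x)) (proj₁ (F₂⁻ F₂x)))
  where
  open IsPGSum pg
  union : ∀ x → E x ≡ (F₁ x ∨ F₂ x)
  union x with F₁ x in e₁ | F₂ x in e₂
  ... | true | _ = ⊆₁ (proj₁ (F₁⁻ e₁)) (proj₂ (F₁⁻ e₁))
  ... | false | true = ⊆₂ (proj₁ (F₂⁻ e₂)) (proj₂ (F₂⁻ e₂))
  ... | false | false = ≢true λ Ex →
    let x≢0 = λ { refl → true≢ Ex E0 }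
    in cover Ex λ where
      (inj₁ s) → true≢ (F₁⁺ (s , x≢0)) e₁
      (inj₂ s) → true≢ (F₂⁺ (s , x≢0)) e₂

-- Descent on `card F`: the minimality required by `Core` is the induction hypothesis, applied to a
-- Boolean flat that represents the smaller subspace.
no-outcome : ∀ {m} (E H : Sub (suc m)) → IsMatroid E → ClawFree E → IsFlatOfDim H m →
  ¬ (∀ x y z → Δ E x y z ≡ false) → ¬ TriangleFreeComplement E →
  (∀ F₁ F₂ → F₁ ∈ˡ all-Sub (suc m) → F₂ ∈ˡ all-Sub (suc m) → ¬ Splits E F₁ F₂) →
  (∀ F → F ∈ˡ all-Sub (suc m) → ¬ IsDecomposer E Gfull F) →
  ∀ k F → card F < k → ¬ IsDecomposer E H F
no-outcome {m} E H E0 claw-free dimH@(flatH , _) ¬quadratic ¬free ¬splits ¬decomposer = go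
  where
  represent : (K : V (suc m) → Set) → ((S : Sub (suc m)) → S ∈ˡ all-Sub (suc m) → Represents S K → ⊥) → ⊥
  represent K k = reify (λ x → K x × x ≢ 0v) λ S S∈ S⁻ S⁺ → k S S∈ (S⁻ , S⁺)
  ¬pg : ¬ (∃ λ S₁ → ∃ λ S₂ → IsPGSum E S₁ S₂)
  ¬pg (S₁ , S₂ , pg) = represent S₁ λ F₁ F₁∈ r₁ → represent S₂ λ F₂ F₂∈ r₂ →
    ¬splits F₁ F₂ F₁∈ F₂∈ (splits E0 pg r₁ r₂)
  no-decomposer : ∀ (S : V (suc m) → Set) → Subspace S → ∀ {x} → S x → x ≢ 0v → ∀ {y} → ¬ S y →
    (∀ {x s} → ¬ S x → S s → E (x ⊕ s) ≡ E x) → ⊥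
  no-decomposer S S≤ Sx x≢0 {y} ¬Sy invariant = represent S λ F F∈ r → ¬decomposer F F∈
    (decomposer-intro r S≤ (λ _ → Gfull⁺) Sx x≢0 (Gfull⁺ {x = y} (λ { refl → ¬Sy (Subspace.0∈ S≤) })) ¬Sy
      (λ _ → invariant) (Gfull-0v {suc m}))
  go : ∀ k F → card F < k → ¬ IsDecomposer E H F
  go (suc k) F (s≤s card≤) d@(flatF , F⊆H , (w , Fw) , (x , Hx , Fx) , _) =
      Core.impossible E (no-claw E0 claw-free) E0 (0∪ H) W (flat-subspace flatH) (flat-subspace flatF) W⊆U
        (hyperplane dimH) invariant w (inj₂ Fw) (flat-≢0 flatF Fw) x (inj₂ Hx) ¬Wx
        minimal no-decomposer ¬quadratic ¬free ¬pg
    where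
    W = 0∪ F
    W⊆U : ∀ {x} → W x → 0∪ H x
    W⊆U (inj₁ e) = inj₁ e
    W⊆U (inj₂ h) = inj₂ (F⊆H _ h)
    invariant : ∀ {x w} → 0∪ H x → ¬ W x → W w → E (x ⊕ w) ≡ E x
    invariant = decomposer-invariant flatH d
    ¬Wx : ¬ W x
    ¬Wx (inj₁ e) = flat-≢0 flatH Hx e
    ¬Wx (inj₂ h) = true≢ h Fx
    F∋ : ∀ {x} → W x → x ≢ 0v → F ∋ x
    F∋ (inj₁ e) x≢0 = ⊥-elim (x≢0 e)
    F∋ (inj₂ h) _ = h
    minimal : ∀ (K : V (suc m) → Set) → Subspace K → (∀ {x} → K x → W x) → ∀ {x} → K x → x ≢ 0v →
      ∀ {w} → W w → ¬ K w → (∀ {v s} → W v → ¬ K v → K s → E (v ⊕ s) ≡ E v) → ⊥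
    minimal K K≤ K⊆W Kx x≢0 {w} Ww ¬Kw inK = represent K λ S _ r@(S⁻ , S⁺) →
      let w≢0 = λ { refl → ¬Kw (Subspace.0∈ K≤) }
          S⊆F = λ {x} (h : S ∋ x) → F∋ (K⊆W (proj₁ (S⁻ h))) (proj₂ (S⁻ h))
      in go k S
        (≤-trans (countL-< S⊆F (≢true (¬Kw ∘ proj₁ ∘ S⁻)) (F∋ Ww w≢0) (∈-allVecs w)) card≤)
        (decomposer-intro r K≤ (λ Kx x≢0 → F⊆H _ (F∋ (K⊆W Kx) x≢0)) Kx x≢0
          (F⊆H _ (F∋ Ww w≢0)) ¬Kw inH (proj₁ flatH))
      where
      -- A subspace of `W` that leaves `f` invariant inside `W` decomposes all of `M|H`, because off
      -- `W` invariance under `W` takes over.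
      inH : ∀ {x s} → H ∋ x → ¬ K x → K s → E (x ⊕ s) ≡ E x
      inH Hx ¬Kx Ks = stable λ ne → by-cases (W _)
        (λ Wx → ne (inK Wx ¬Kx Ks)) (λ ¬Wx → ne (invariant (inj₂ Hx) ¬Wx (K⊆W Ks)))

theorem5p1 : (m : ℕ) (E H : Sub (suc m)) → IsMatroid E → ClawFree E →
    IsFlatOfDim H m → HasDecomposer E H →
    EvenPlane E ⊎ PGSum E ⊎ ComplementTriangleFree E ⊎ HasDecomposer E Gfull
theorem5p1 m E H E0 claw-free dimH (F , d)
  with all-V? (λ x → all-V? (λ y → all-V? (λ z → Δ E x y z ≟ᵇ false)))
     | any? (λ F₁ → any? (Splits? E F₁) (all-Sub (suc m))) (all-Sub (suc m))
     | all-V? (λ x → all-V? (λ y → ¬? (x ≟ᵛ 0v) →-dec (¬? (y ≟ᵛ 0v) →-dec (¬? (x ≟ᵛ y) →-dec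
         ((E x ≟ᵇ false) →-dec ((E y ≟ᵇ false) →-dec (¬? (E (x ⊕ y) ≟ᵇ false))))))))
     | any? (IsDecomposer? E Gfull) (all-Sub (suc m))
... | yes quadratic | _ | _ | _ = inj₁ (quadratic⇒EvenPlane E0 quadratic)
... | no _ | yes pg | _ | _ = let (F₁ , h) = satisfied pg in inj₂ (inj₁ (F₁ , satisfied h))
... | no _ | no _ | yes free | _ = inj₂ (inj₂ (inj₁ (triangle-free-complement free)))
... | no _ | no _ | no _ | yes h = inj₂ (inj₂ (inj₂ (satisfied h)))
... | no ¬quadratic | no ¬pg | no ¬free | no ¬d = ⊥-elim
  (no-outcome E H E0 claw-free dimH ¬quadratic ¬free
    (λ F₁ F₂ F₁∈ F₂∈ s → ¬pg (lose F₁∈ (lose F₂∈ s))) (λ F F∈ h → ¬d (lose F∈ h))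
    (suc (card F)) F ≤-refl d)
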